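{- Let $G=(V,E)$ be a finite connected simple undirected graph (no multi-edges, no loops), let $d_v$ denote the degree of $v$ in $G$, let $\tau(G)$ be the number of spanning trees of $G$, and let $x,y\in V$. Then $$H(x,y)=\frac{1}{\tau(G)}\sum_{u\in V}d_u\sum_{\substack{P\in\mathscr P_G(x,u)\\ y\notin P}}R\big(G-\{P,y\},d_G\big).$$ Moreover, for every such path $P$ (with $y\notin P$), $R(G-\{P,y\},d_G)=\tau(G/\{P,y\})$.
   Context: $H(x,y)$ is the hitting time of the simple random walk on $G$ (which at each step moves from the current vertex $v$ to a uniformly random neighbor, each with probability $1/d_v$): the expected number of steps to reach $y$ when started at $x$. $\mathscr P_G(x,u)$ is the set of simple paths (no repeated vertices) in $G$ from $x$ to $u$; by convention $\mathscr P_G(x,x)$ consists only of the trivial path $\{x\}$. "$y\notin P$" means $y$ is not a vertex of $P$. $G-\{P,y\}$ is the induced subgraph of $G$ obtained by deleting all vertices of $P$ and the vertex $y$, and $d_G$ denotes the weight function $v\mapsto d_v$ (degrees in $G$) restricted to that subgraph. $G/\{P,y\}$ is the multigraph obtained from $G$ by identifying all vertices of $P$ together with $y$ into a single vertex (keeping multiple edges, deleting loops); its spanning trees are counted with edge multiplicities. For a vertex-weighted graph $(G',w)$ (a finite simple graph $G'$ with $w:V(G')\to\mathbb R$), the invariant $R(G',w)$ is defined by $R(\emptyset,w)=1$ and, for any vertex $x$ of $G'$, $$R(G',w)=w_xR(G'-\{x\},w)-\sum_{\substack{z\in V(G')\\ z\sim x}}\sum_{Q\in\mathscr P_{G'}(x,z)}R(G'-\{Q\},w),$$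 where $z\sim x$ means adjacency, $G'-\{Q\}$ deletes the vertices of $Q$, and $w$ is restricted to subgraphs; these relations determine $R$ uniquely (independently of the choice of $x$). Equivalently, when $w$ is integer-valued with $w_v\ge \deg_{G'}(v)$, $R(G',w)$ equals the number of spanning trees of the multigraph obtained from $G'$ by adding a new vertex $\bullet$ and $w_v-\deg_{G'}(v)$ edges between $\bullet$ and $v$ for each $v$. -}

module Defs where

open import Data.Nat as ℕ using (ℕ; zero; suc; _∸_)
open import Data.Nat.Properties using () renaming (_≟_ to _≟ℕ_)
open import Data.Integer as ℤ using (ℤ; +_)
open import Data.Rational as ℚ using (ℚ; 0ℚ; 1ℚ)
open import Data.Fin using (Fin; zero; suc; toℕ)
open import Data.Fin.Properties using (_≟_)
open import Data.Bool using (Bool; true; false; if_then_else_; _∧_; _∨_; not)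
open import Data.List using (List; []; _∷_; map; concatMap; foldr; length; filter)
open import Data.List as L using ()
open import Data.Vec using (Vec; []; _∷_)
open import Data.Maybe using (Maybe; just; nothing)
open import Data.Product using (_×_; _,_; proj₁; proj₂)
open import Relation.Nullary.Decidable using (⌊_⌋)
open import Relation.Binary.PropositionalEquality using (_≡_)

record Graph (n : ℕ) : Set where
  field
    adj    : Fin n → Fin n → Bool
    sym    : ∀ i j → adj i j ≡ adj j i
    irrefl : ∀ i → adj i i ≡ false
open Graph public

data Walk {n} (G : Graph n) : Fin n → Fin n → Set where
  here : ∀ {u} → Walk G u u
  step : ∀ {u v w} → adj G u v ≡ true → Walk G v w → Walk G u w

Connected : ∀ {n} → Graph n → Set
Connected G = ∀ u v → Walk G u v

allFin : ∀ n → List (Fin n)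
allFin zero    = []
allFin (suc n) = zero ∷ map suc (allFin n)

_==_ : ∀ {n} → Fin n → Fin n → Bool
i == j = ⌊ i ≟ j ⌋

countB : ∀ {n} → (Fin n → Bool) → ℕ
countB {n} p = length (filter (λ i → Data.Bool._≟_ (p i) true) (allFin n))
  where import Data.Bool

sumℤ : List ℤ → ℤ
sumℤ = foldr ℤ._+_ (+ 0)

sumℚ : List ℚ → ℚ
sumℚ = foldr ℚ._+_ 0ℚ

elem : ∀ {n} → Fin n → List (Fin n) → Bool
elem y []       = false
elem y (v ∷ vs) = (y == v) ∨ elem y vs

deg : ∀ {n} → Graph n → Fin n → ℕ
deg G v = countB (adj G v)

VSet : ℕ → Set
VSet n = Fin n → Bool

full : ∀ {n} → VSet n
full _ = true

removeL : ∀ {n} → List (Fin n) → VSet n → VSet n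
removeL vs S v = S v ∧ not (elem v vs)

first : ∀ {n} → VSet n → Maybe (Fin n)
first {zero}  S = nothing
first {suc n} S with S zero
... | true  = just zero
... | false with first {n} (λ i → S (suc i))
...   | just i  = just (suc i)
...   | nothing = nothing

-- Simple paths in the induced subgraph G[S] from a to b, as vertex lists
-- a ∷ ... ∷ b (no repeated vertex).  By convention the only path from a
-- to a is the trivial path [ a ].  The fuel bounds the number of edges;
-- fuel n suffices (a simple path has at most n-1 edges).

pathsF : ∀ {n} → Graph n → ℕ → VSet n → Fin n → Fin n → List (List (Fin n))
pathsF G f S a b with S a | a == b
pathsF G f       S a b | false | _    = []
pathsF G f       S a b | true  | true = (a ∷ []) ∷ []
pathsF G zero    S a b | true  | false = []
pathsF G (suc f) S a b | true  | false =
  concatMap (λ v → if adj G a v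
                   then map (a ∷_) (pathsF G f (removeL (a ∷ []) S) v b)
                   else [])
            (allFin _)

paths : ∀ {n} → Graph n → VSet n → Fin n → Fin n → List (List (Fin n))
paths {n} G S a b = pathsF G n S a b

-- The invariant R(G[S], w) of a vertex-weighted induced subgraph G[S],
-- via the defining recursion, expanding at the least vertex x of S:
--   R(S) = w_x R(S - x) - Σ_{z ∈ S, z ~ x} Σ_{Q ∈ 𝒫_{G[S]}(x,z)} R(S - Q),
--   R(∅) = 1.
-- The fuel bounds |S|; fuel n suffices.

RF : ∀ {n} → Graph n → (Fin n → ℤ) → ℕ → VSet n → ℤ
RF G w zero    S = + 1
RF G w (suc f) S with first S
... | nothing = + 1
... | just x  =
  w x ℤ.* RF G w f (removeL (x ∷ []) S)
  ℤ.- sumℤ (map (λ z → if S z ∧ adj G x z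
                         then sumℤ (map (λ Q → RF G w f (removeL Q S)) (paths G S x z))
                         else + 0)
                (allFin _))

R : ∀ {n} → Graph n → (Fin n → ℤ) → VSet n → ℤ
R {n} G w S = RF G w n S

dG : ∀ {n} → Graph n → Fin n → ℤ
dG G v = + deg G v

-- Spanning trees of multigraphs.
-- A multigraph is given by a vertex set V ⊆ Fin n and a list of edges
-- (pairs of vertices of V, no loops); parallel edges are distinct list
-- entries.  A spanning tree is a set of edges (a Bool-vector selecting
-- list entries) with exactly |V| - 1 edges that connects all of V.

record MGraph (n : ℕ) : Set where
  field
    verts : VSet n
    edges : List (Fin n × Fin n)
open MGraph public

allSubsets : ∀ m → List (Vec Bool m)
allSubsets zero    = [] ∷ []
allSubsets (suc m) = concatMap (λ s → (true ∷ s) ∷ (false ∷ s) ∷ []) (allSubsets m)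

selected : ∀ {A : Set} (es : List A) → Vec Bool (length es) → List A
selected []       []          = []
selected (e ∷ es) (true ∷ s)  = e ∷ selected es s
selected (e ∷ es) (false ∷ s) = selected es s

grow : ∀ {n} → List (Fin n × Fin n) → VSet n → VSet n
grow T Rch v = Rch v ∨ L.foldr (λ e acc → acc ∨ ((Rch (proj₁ e) ∧ (v == proj₂ e))
                                                ∨ (Rch (proj₂ e) ∧ (v == proj₁ e)))) false T

iter : ∀ {A : Set} → ℕ → (A → A) → A → A
iter zero    f a = a
iter (suc k) f a = f (iter k f a)

connectedB : ∀ {n} → VSet n → List (Fin n × Fin n) → Bool
connectedB {n} V T with first V
... | nothing = true
... | just r  =
  let Rch = iter n (grow T) (λ v → v == r)
  in L.foldr (λ v acc → acc ∧ (not (V v) ∨ Rch v)) true (allFin n)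

isSpanningTree : ∀ {n} (M : MGraph n) → Vec Bool (length (edges M)) → Bool
isSpanningTree M s =
  ⌊ length (selected (edges M) s) ≟ℕ (countB (verts M) ∸ 1) ⌋
  ∧ connectedB (verts M) (selected (edges M) s)

τ : ∀ {n} → MGraph n → ℕ
τ M = length (filter (λ s → Data.Bool._≟_ (isSpanningTree M s) true)
                     (allSubsets (length (edges M))))
  where import Data.Bool

edgeList : ∀ {n} → Graph n → List (Fin n × Fin n)
edgeList {n} G =
  concatMap (λ i → concatMap (λ j → if ⌊ toℕ i ℕ.<? toℕ j ⌋ ∧ adj G i j
                                     then (i , j) ∷ [] else [])
                             (allFin n))
            (allFin n)

asMG : ∀ {n} → Graph n → MGraph n
asMG G = record { verts = full ; edges = edgeList G }

-- G / C : identify all vertices of C (a nonempty list containing y) into the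
-- single vertex y, keep multiple edges, delete loops.
contractTo : ∀ {n} → Graph n → List (Fin n) → Fin n → MGraph n
contractTo G C y = record
  { verts = λ v → not (elem v C) ∨ (v == y)
  ; edges = concatMap (λ e → let a = φ (proj₁ e) ; b = φ (proj₂ e)
                             in if a == b then [] else (a , b) ∷ [])
                      (edgeList G)
  }
  where
  φ : _ → _
  φ v = if elem v C then y else v

-- Hitting time of the simple random walk.
-- q t v = P(X_t = v, T_y > t) for the walk started at x, where
-- T_y = min { t ≥ 0 : X_t = y }.  Then P(T_y > t) = Σ_v q t v, and
-- H(x,y) = E[T_y] = Σ_{t ≥ 0} P(T_y > t) (tail-sum formula, valid also
-- when T_y = ∞ has positive probability).

recip : ℕ → ℚ
recip zero    = 0ℚ
recip (suc k) = + 1 ℚ./ suc k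

toℚ : ℤ → ℚ
toℚ z = z ℚ./ 1

ofℕ : ℕ → ℚ
ofℕ k = + k ℚ./ 1

q : ∀ {n} → Graph n → Fin n → Fin n → ℕ → Fin n → ℚ
q G x y zero    v = if (v == x) ∧ not (x == y) then 1ℚ else 0ℚ
q G x y (suc t) v =
  if v == y then 0ℚ
  else sumℚ (map (λ u → if adj G u v then q G x y t u ℚ.* recip (deg G u) else 0ℚ)
                 (allFin _))

tailProb : ∀ {n} → Graph n → Fin n → Fin n → ℕ → ℚ
tailProb G x y t = sumℚ (map (q G x y t) (allFin _))

partialH : ∀ {n} → Graph n → Fin n → Fin n → ℕ → ℚ
partialH G x y zero    = 0ℚ
partialH G x y (suc N) = partialH G x y N ℚ.+ tailProb G x y N

ConvergesTo : (ℕ → ℚ) → ℚ → Set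
ConvergesTo s L = ∀ (ε : ℚ) → 0ℚ ℚ.< ε →
  Data.Product.∃ λ N → ∀ m → N ℕ.≤ m → ℚ.∣ s m ℚ.- L ∣ ℚ.< ε
  where import Data.Product

HittingTime≡ : ∀ {n} → Graph n → Fin n → Fin n → ℚ → Set
HittingTime≡ G x y h = ConvergesTo (partialH G x y) h

minusPy : ∀ {n} → List (Fin n) → Fin n → VSet n
minusPy P y = removeL (y ∷ P) full

pathSum : ∀ {n} → Graph n → Fin n → Fin n → ℤ
pathSum G x y =
  sumℤ (map (λ u → dG G u ℤ.* sumℤ (map (λ P → if elem y P then + 0
                                                else R G (dG G) (minusPy P y))
                                         (paths G full x u)))
            (allFin _))

{-# OPTIONS --safe #-}

-- Let L = D − A and let S be a vertex set.  The recursion for R is a Laplace expansion, so R(G[S], d) is the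
-- principal minor det L[S], and adj S v u = Σ_P R(S − P), summed over the simple paths P from v to u in S, should be
-- the adjugate of L[S].  Removing the first vertex of a path gives the off-diagonal entries of adj · L = det · I by
-- induction on |S|; the diagonal entries are the expansions of the minor at the various vertices.  Comparing the two
-- ways to evaluate L · adj · L shows that the expansions at two vertices agree if the corresponding entry of L is
-- nonzero, and otherwise one perturbs that entry by t and interpolates, both expansions being quadratic in t.
--
-- Deletion–contraction at an edge leaving the complement of S identifies det L[S] with the number of spanning trees of
-- G / (V − S); when there is no such edge, the rows of L[S] sum to zero.
--
-- With S = V − y, the identity L · adj = det · I says that h(v) = τ(G)⁻¹ Σ_u d_u adj S v u solves the first-step
-- equations of the hitting time.  Hence E[h(X_t) ; T_y > t] decreases by exactly P(T_y > t) at each step, and as h is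
-- bounded this expectation is O(1/t), so that Σ_t P(T_y > t) converges to h(x).

module Submission where

open import Defs hiding (sym)
open import Algebra.Bundles using (CommutativeRing)
open import Data.Bool using (Bool; true; false; not; _∧_; _∨_; if_then_else_)
import Data.Bool.Properties as Boolₚ
open import Data.Fin using (Fin; zero; suc; toℕ)
open import Data.Fin.Properties as Finₚ using (_≟_; suc-injective)
open import Data.Fin.Subset using (Subset; ∣_∣) renaming (⊤ to ⊤ₛ)
import Data.Fin.Subset.Properties as Subsetₚ
open import Data.Integer as ℤ using (ℤ; +_; _+_; _*_; _-_; -_)
import Data.Integer.Properties as ℤₚ
open import Data.Integer.Tactic.RingSolver using (solve-∀)
open import Data.List using (List; []; _∷_; _++_; length; foldr; map; filter; concatMap)
open import Data.List.Membership.Propositional using (_∈_; lose)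
open import Data.List.Membership.Propositional.Properties using (∈-concatMap⁺; ∈-map⁺)
import Data.List.Properties as Listₚ
open import Data.List.Relation.Binary.Permutation.Propositional using (_↭_; refl; prep; swap; ↭-trans; ↭-sym) renaming (trans to ↭-chain)
open import Data.List.Relation.Binary.Permutation.Propositional.Properties using (∈-resp-↭; ↭-length)
open import Data.List.Relation.Unary.All as All using (All; []; _∷_)
import Data.List.Relation.Unary.All.Properties as Allₚ
open import Data.List.Relation.Unary.Any using (here; there)
open import Data.Maybe using (just; nothing; maybe)
open import Data.Nat as ℕ using (ℕ; zero; suc)
import Data.Nat.Properties as ℕₚ
open import Data.Nat.Tactic.RingSolver using () renaming (solve-∀ to solve-∀ℕ)
open import Data.Product using (_×_; _,_; proj₁; proj₂; ∃)
open import Data.Rational as ℚ using (ℚ; 0ℚ; 1ℚ; fromℚᵘ)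
import Data.Rational.Properties as ℚₚ
open import Data.Rational.Solver using (module +-*-Solver)
open import Data.Rational.Unnormalised as ℚᵘ using (mkℚᵘ; *≡*)
import Data.Rational.Unnormalised.Properties as ℚᵘₚ
open import Data.Sum using (_⊎_; inj₁; inj₂)
open import Data.Unit using (⊤; tt)
open import Data.Vec using (Vec; []; _∷_; lookup; _[_]≔_; tabulate)
import Data.Vec.Properties as Vecₚ
open import Function using (_∘_; case_of_)
open import Relation.Binary.Definitions using (tri<; tri≈; tri>)
open import Relation.Binary.PropositionalEquality
open import Relation.Nullary using (¬_; yes; no; contradiction)
open import Relation.Nullary.Decidable using (toSum; ⌊_⌋; isYes≗does)
open import Algebra.Properties.Semiring.Sum ℤₚ.+-*-semiring using (sum; sum-cong-≗; ∑-comm; ∑-distrib-+; *-distribˡ-sum; *-distribʳ-sum)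
import Algebra.Properties.Semiring.Sum (CommutativeRing.semiring ℚₚ.+-*-commutativeRing) as ∑ℚ

-- The induction runs over all symmetric integer matrices, because the perturbation by t leaves the
-- Laplacians of graphs; these return only when trees are counted. The determinant is defined by
-- path expansion at the least vertex, so that it unfolds in the same way as `R`; the price is that
-- the usual facts about determinants have to be won from this recursion. No circle arises: the
-- off-diagonal part of adj · L = det · I on S follows from the full identity on smaller sets and
-- does not mention the minor of S, so it is available when the expansions at the vertices of S are
-- compared.
--
-- Trees are counted relative to a root set, the complement of S, instead of in a sequence of
-- contracted graphs. Contracting an edge then merely removes one vertex from S, and the remaining
-- edges stay as they are.
--
-- The tree count is used three times: for the contracted graphs, for τ(G) > 0, and for the
-- nonnegativity of all minors. The last makes the adjugate nonnegative, hence also the potential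
-- whose decay gives the convergence.

private variable
  n : ℕ
  A A′ : Set

-- Principal minors of symmetric matrices

==-refl : (i : Fin n) → (i == i) ≡ true
==-refl i with i ≟ i
... | yes _ = refl
... | no i≢i = contradiction refl i≢i

==-≢ : {i j : Fin n} → i ≢ j → (i == j) ≡ false
==-≢ {i = i} {j} i≢j with i ≟ j
... | yes i≡j = contradiction i≡j i≢j
... | no _ = refl

==-sound : {i j : Fin n} → (i == j) ≡ true → i ≡ j
==-sound {i = i} {j} e with i ≟ j
... | yes i≡j = i≡j

ind : Bool → ℤ
ind true  = + 1
ind false = + 0

δ : Fin n → Fin n → ℤ
δ i j = ind (i == j)

δ-refl : (i : Fin n) → δ i i ≡ + 1
δ-refl i = cong ind (==-refl i)

δ-≢ : {i j : Fin n} → i ≢ j → δ i j ≡ + 0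
δ-≢ i≢j = cong ind (==-≢ i≢j)

δ-sym : (i j : Fin n) → δ i j ≡ δ j i
δ-sym i j with i ≟ j
... | yes refl = sym (δ-refl i)
... | no i≢j = sym (δ-≢ (i≢j ∘ sym))

sum-zero : {f : Fin n → ℤ} → (∀ i → f i ≡ + 0) → sum f ≡ + 0
sum-zero {zero}  f≡0 = refl
sum-zero {suc n} f≡0 = cong₂ _+_ (f≡0 zero) (sum-zero (f≡0 ∘ suc))

sum-single : (f : Fin n → ℤ) (u : Fin n) → (∀ i → i ≢ u → f i ≡ + 0) → sum f ≡ f u
sum-single f zero h =
  trans (cong (_+_ (f zero)) (sum-zero λ i → h (suc i) λ ())) (ℤₚ.+-identityʳ _)
sum-single f (suc u) h =
  trans (cong (_+ sum (f ∘ suc)) (h zero λ ()))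
        (trans (ℤₚ.+-identityˡ _) (sum-single (f ∘ suc) u λ i i≢u → h (suc i) (i≢u ∘ suc-injective)))

sum-δˡ : (f : Fin n → ℤ) (u : Fin n) → sum (λ i → δ u i * f i) ≡ f u
sum-δˡ f u = trans
  (sum-single _ u λ i i≢u → cong (_* f i) (δ-≢ (i≢u ∘ sym)))
  (trans (cong (_* f u) (δ-refl u)) (ℤₚ.*-identityˡ _))

sum-δʳ : (f : Fin n → ℤ) (u : Fin n) → sum (λ i → f i * δ i u) ≡ f u
sum-δʳ f u = trans
  (sum-cong-≗ λ i → trans (ℤₚ.*-comm (f i) (δ i u)) (cong (_* f i) (δ-sym i u)))
  (sum-δˡ f u)

sum-neg : (f : Fin n → ℤ) → sum (λ i → - f i) ≡ - sum f
sum-neg {zero} f = refl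
sum-neg {suc n} f = trans (cong (_+_ (- f zero)) (sum-neg (f ∘ suc))) (sym (ℤₚ.neg-distrib-+ (f zero) _))

sum-sub : (f g : Fin n → ℤ) → sum (λ i → f i - g i) ≡ sum f - sum g
sum-sub f g = trans (∑-distrib-+ f (λ i → - g i)) (cong (_+_ (sum f)) (sum-neg g))

-- Associativity (a · X) · b = a · (X · b), the form in which products with an adjugate are
-- regrouped.
sum-assoc : (a : Fin n → ℤ) (X : Fin n → Fin n → ℤ) (b : Fin n → ℤ) →
  sum (λ u → sum (λ z → a z * X z u) * b u) ≡ sum (λ z → a z * sum (λ u → X z u * b u))
sum-assoc a X b = begin
  sum (λ u → sum (λ z → a z * X z u) * b u)
    ≡⟨ sum-cong-≗ (λ u → *-distribʳ-sum (b u) (λ z → a z * X z u)) ⟩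
  sum (λ u → sum (λ z → a z * X z u * b u))
    ≡⟨ ∑-comm (λ u z → a z * X z u * b u) ⟩
  sum (λ z → sum (λ u → a z * X z u * b u))
    ≡⟨ sum-cong-≗ (λ z → trans (sum-cong-≗ λ u → ℤₚ.*-assoc (a z) (X z u) (b u))
                                (sym (*-distribˡ-sum (a z) (λ u → X z u * b u)))) ⟩
  sum (λ z → a z * sum (λ u → X z u * b u)) ∎
  where open ≡-Reasoning

-- Subsets of the vertices

infix 4 _∋_ _∌_
infixl 6 _∖_

-- Sets are Boolean vectors here, not functions as in `VSet`: sets with the same members are then
-- equal (`∖-comm`, `subset-ext`) and can be substituted in `det` and `adjM`.
_∋_ _∌_ : Subset n → Fin n → Set
S ∋ v = lookup S v ≡ true
S ∌ v = lookup S v ≡ false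

_∖_ : Subset n → Fin n → Subset n
S ∖ a = S [ a ]≔ false

∖-self : (S : Subset n) (a : Fin n) → S ∖ a ∌ a
∖-self S a = Vecₚ.lookup∘update a S false

∖-other : (S : Subset n) {a v : Fin n} → v ≢ a → lookup (S ∖ a) v ≡ lookup S v
∖-other S v≢a = Vecₚ.lookup∘update′ v≢a S false

∖-comm : (S : Subset n) (a b : Fin n) → S ∖ a ∖ b ≡ S ∖ b ∖ a
∖-comm S a b with a ≟ b
... | yes refl = refl
... | no a≢b = Vecₚ.[]≔-commutes S a b a≢b

∌-∋ : (S : Subset n) {v : Fin n} {A : Set} → S ∌ v → S ∋ v → A
∌-∋ S p q = case trans (sym p) q of λ ()

∌-∖ : (S : Subset n) {v : Fin n} (a : Fin n) → S ∌ v → S ∖ a ∌ v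
∌-∖ S {v} a p with v ≟ a
... | yes refl = ∖-self S a
... | no v≢a = trans (∖-other S v≢a) p

∖-∋ : (S : Subset n) {a v : Fin n} → S ∖ a ∋ v → v ≢ a × S ∋ v
∖-∋ S {a} {v} p with v ≟ a
... | yes refl = ∌-∋ (S ∖ a) (∖-self S a) p
... | no v≢a = v≢a , trans (sym (∖-other S v≢a)) p

∋? : (S : Subset n) (v : Fin n) → S ∋ v ⊎ S ∌ v
∋? S v with lookup S v
... | true = inj₁ refl
... | false = inj₂ refl

∣∖∣ : (S : Subset n) (a : Fin n) → S ∋ a → ∣ S ∣ ≡ suc ∣ S ∖ a ∣
∣∖∣ (true ∷ S) zero p = refl
∣∖∣ (true ∷ S) (suc a) p = cong suc (∣∖∣ S a p)
∣∖∣ (false ∷ S) (suc a) p = ∣∖∣ S a p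

∣∖∣-pred : (S : Subset n) (a : Fin n) {k : ℕ} → S ∋ a → ∣ S ∣ ℕ.≤ suc k → ∣ S ∖ a ∣ ℕ.≤ k
∣∖∣-pred S a {k} p le = ℕ.s≤s⁻¹ (subst (ℕ._≤ suc k) (∣∖∣ S a p) le)

∣∣≤0 : (S : Subset n) → ∣ S ∣ ℕ.≤ 0 → ∀ v → S ∌ v
∣∣≤0 S le v with ∋? S v
... | inj₂ q = q
... | inj₁ p = case subst (ℕ._≤ 0) (∣∖∣ S v p) le of λ ()

empty-∣∣ : (S : Subset n) → (∀ v → S ∌ v) → ∣ S ∣ ≡ 0
empty-∣∣ [] h = refl
empty-∣∣ (false ∷ S) h = empty-∣∣ S (h ∘ suc)
empty-∣∣ (true ∷ S) h = case h zero of λ ()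

first-just : (S : VSet n) {x : Fin n} → first S ≡ just x → S x ≡ true
first-just {suc n} S e with S zero in e₀
first-just {suc n} S refl | true = e₀
... | false with first (λ i → S (suc i)) in e₁
first-just {suc n} S refl | false | just i = first-just (λ i → S (suc i)) e₁

first-nothing : (S : VSet n) → first S ≡ nothing → ∀ v → S v ≡ false
first-nothing {suc n} S e v with S zero in e₀
... | false with first (λ i → S (suc i)) in e₁
first-nothing {suc n} S e zero | false | nothing = e₀
first-nothing {suc n} S e (suc v) | false | nothing = first-nothing (λ i → S (suc i)) e₁ v

-- Path expansions of the adjugate and the determinant

Matrix : ℕ → Set
Matrix n = Fin n → Fin n → ℤ

Symmetric : Matrix n → Set
Symmetric L = ∀ i j → L i j ≡ L j i

-- Up to the weights of the edges, adjF L k S v u is the sum of det(S − P) over the simple paths P from v to u in S.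
-- The fuel k is sufficient as soon as k ≥ ∣ S ∣.
adjF : Matrix n → ℕ → Subset n → Matrix n
detF : Matrix n → ℕ → Subset n → ℤ

adjF L zero    S v u = + 0
adjF L (suc k) S v u = ind (lookup S v) *
  (δ v u * detF L k (S ∖ v) - sum (λ z → L v z * adjF L k (S ∖ v) z u))

detF L zero    S = + 1
detF L (suc k) S = maybe (λ x → sum (λ z → L x z * adjF L (suc k) S x z)) (+ 1) (first (lookup S))

-- With fuel exactly `∣ S ∣`, rewriting by `∣∖∣` unfolds the recursion at a vertex of S and leaves
-- exactly the right fuel for the smaller set, so values with different fuel are never compared.
adjM : Matrix n → Subset n → Matrix n
adjM L S = adjF L ∣ S ∣ S

det : Matrix n → Subset n → ℤ
det L S = detF L ∣ S ∣ S

-- Laplace expansion along the row of v. For the least vertex of S it is `det` by definition; for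
-- the others this is `det-expand`.
expand : Matrix n → Subset n → Fin n → ℤ
expand L S v = sum (λ z → L v z * adjM L S v z)

adjF-out : (L : Matrix n) (k : ℕ) (S : Subset n) {v : Fin n} (u : Fin n) → S ∌ v → adjF L k S v u ≡ + 0
adjF-out L zero S u p = refl
adjF-out L (suc k) S u p rewrite p = refl

adj-out : (L : Matrix n) (S : Subset n) {v : Fin n} (u : Fin n) → S ∌ v → adjM L S v u ≡ + 0
adj-out L S = adjF-out L ∣ S ∣ S

adj-in : (L : Matrix n) (S : Subset n) {v : Fin n} (u : Fin n) → S ∋ v →
  adjM L S v u ≡ δ v u * det L (S ∖ v) - sum (λ z → L v z * adjM L (S ∖ v) z u)
adj-in L S {v} u p rewrite ∣∖∣ S v p | p = ℤₚ.*-identityˡ _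

det-empty : (L : Matrix n) (S : Subset n) → ∣ S ∣ ≡ 0 → det L S ≡ + 1
det-empty L S e rewrite e = refl

det-first : (L : Matrix n) (S : Subset n) {x : Fin n} → first (lookup S) ≡ just x → det L S ≡ expand L S x
det-first L S {x} e rewrite ∣∖∣ S x (first-just (lookup S) e) | e = refl

adjF-outʳ : (L : Matrix n) (k : ℕ) (S : Subset n) (v : Fin n) {u : Fin n} → S ∌ u → adjF L k S v u ≡ + 0
adjF-outʳ L zero S v q = refl
adjF-outʳ L (suc k) S v {u} q with ∋? S v
... | inj₂ p = adjF-out L (suc k) S u p
... | inj₁ p = trans
  (cong₂ (λ a b → ind (lookup S v) * (a * detF L k (S ∖ v) - b))
    (δ-≢ {i = v} {u} λ { refl → ∌-∋ S q p })
    (sum-zero λ z → trans (cong (L v z *_) (adjF-outʳ L k (S ∖ v) z (∌-∖ S v q))) (ℤₚ.*-zeroʳ (L v z))))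
  (ℤₚ.*-zeroʳ (ind (lookup S v)))

adj-zeroʳ : (L : Matrix n) (S : Subset n) (v : Fin n) {u : Fin n} → S ∌ u → adjM L S v u ≡ + 0
adj-zeroʳ L S = adjF-outʳ L ∣ S ∣ S

-- Once v is removed no path can end at v, so only the trivial path survives. This matches the
-- convention for paths from a vertex to itself.
adj-diag : (L : Matrix n) (S : Subset n) {v : Fin n} → S ∋ v → adjM L S v v ≡ det L (S ∖ v)
adj-diag L S {v} p = begin
  adjM L S v v ≡⟨ adj-in L S v p ⟩
  δ v v * det L (S ∖ v) - sum (λ z → L v z * adjM L (S ∖ v) z v)
    ≡⟨ cong₂ (λ a b → a * det L (S ∖ v) - b) (δ-refl v)
         (sum-zero λ z → trans (cong (L v z *_) (adj-zeroʳ L (S ∖ v) z (∖-self S v))) (ℤₚ.*-zeroʳ (L v z))) ⟩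
  + 1 * det L (S ∖ v) - + 0 ≡⟨ lem _ ⟩
  det L (S ∖ v) ∎
  where
  open ≡-Reasoning
  lem : ∀ d → + 1 * d - + 0 ≡ d
  lem = solve-∀

adj-step : (L : Matrix n) (S : Subset n) {v u : Fin n} → S ∋ v → v ≢ u →
  adjM L S v u ≡ - sum (λ z → L v z * adjM L (S ∖ v) z u)
adj-step L S {v} {u} p v≢u = trans (adj-in L S u p)
  (trans (cong (λ a → a * det L (S ∖ v) - sum (λ z → L v z * adjM L (S ∖ v) z u)) (δ-≢ {i = v} {u} v≢u)) (ℤₚ.+-identityˡ _))

-- Reversal of paths. The recursion peels off the start only and hides this symmetry, which is what
-- turns statements on adj · L into statements on L · adj.
adj-sym-size : {L : Matrix n} → Symmetric L → (k : ℕ) (S : Subset n) → ∣ S ∣ ℕ.≤ k → (a b : Fin n) → adjM L S a b ≡ adjM L S b a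

-- Removing both ends of a path turns the recursion into an expression symmetric in a and b.
adj-two : {L : Matrix n} → Symmetric L → (k : ℕ) (S : Subset n) → ∣ S ∣ ℕ.≤ suc k → {a b : Fin n} → S ∋ a → S ∋ b → a ≢ b →
  adjM L S a b ≡ - (L a b * det L (S ∖ a ∖ b) - sum (λ z → sum (λ s → L a z * (L b s * adjM L (S ∖ a ∖ b) s z))))
adj-two {L = L} L-sym k S e {a} {b} pa pb a≢b = begin
  adjM L S a b ≡⟨ adj-step L S pa a≢b ⟩
  - sum (λ z → L a z * adjM L (S ∖ a) z b)
    ≡⟨ cong -_ (sum-cong-≗ λ z → cong (L a z *_) (trans (adj-sym-size L-sym k (S ∖ a) (∣∖∣-pred S a pa e) z b)
                                               (adj-in L (S ∖ a) z (trans (∖-other S (a≢b ∘ sym)) pb)))) ⟩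
  - sum (λ z → L a z * (δ b z * D - sum (λ s → L b s * adjM L T s z)))
    ≡⟨ cong -_ (sum-cong-≗ λ z → trans (lem (L a z) (δ b z) D (sum (λ s → L b s * adjM L T s z)))
         (cong (λ h → δ b z * (L a z * D) - h) (*-distribˡ-sum (L a z) (λ s → L b s * adjM L T s z)))) ⟩
  - sum (λ z → δ b z * (L a z * D) - sum (λ s → L a z * (L b s * adjM L T s z)))
    ≡⟨ cong -_ (trans (sum-sub _ (λ z → sum (λ s → L a z * (L b s * adjM L T s z))))
         (cong (_- sum (λ z → sum (λ s → L a z * (L b s * adjM L T s z)))) (sum-δˡ (λ z → L a z * D) b))) ⟩
  - (L a b * D - sum (λ z → sum (λ s → L a z * (L b s * adjM L T s z)))) ∎
  where
  open ≡-Reasoning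
  T = S ∖ a ∖ b
  D = det L T
  lem : ∀ l d D x → l * (d * D - x) ≡ d * (l * D) - l * x
  lem = solve-∀

adj-sym-size L-sym zero S e a b =
  trans (adj-out _ S b (∣∣≤0 S e a)) (sym (adj-out _ S a (∣∣≤0 S e b)))
adj-sym-size {L = L} L-sym (suc k) S e a b with ∋? S a | ∋? S b | a ≟ b
... | inj₂ p | _ | _ = trans (adj-out L S b p) (sym (adj-zeroʳ L S b p))
... | inj₁ _ | inj₂ p | _ = trans (adj-zeroʳ L S a p) (sym (adj-out L S a p))
... | inj₁ _ | inj₁ _ | yes refl = refl
... | inj₁ pa | inj₁ pb | no a≢b = begin
  adjM L S a b ≡⟨ adj-two L-sym k S e pa pb a≢b ⟩
  - (L a b * det L T - sum (λ z → sum (λ s → L a z * (L b s * adjM L T s z))))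
    ≡⟨ cong -_ (cong₂ _-_ (cong₂ _*_ (L-sym a b) (cong (det L) T≡T′)) inner) ⟩
  - (L b a * det L T′ - sum (λ s → sum (λ z → L b s * (L a z * adjM L T′ z s))))
    ≡⟨ sym (adj-two L-sym k S e pb pa (a≢b ∘ sym)) ⟩
  adjM L S b a ∎
  where
  open ≡-Reasoning
  T = S ∖ a ∖ b
  T′ = S ∖ b ∖ a
  T≡T′ : T ≡ T′
  T≡T′ = ∖-comm S a b
  ih : ∀ s z → adjM L T s z ≡ adjM L T z s
  ih = adj-sym-size L-sym k T (∣∖∣-pred (S ∖ a) b (trans (∖-other S (a≢b ∘ sym)) pb) (ℕₚ.m≤n⇒m≤1+n (∣∖∣-pred S a pa e)))
  exchange : ∀ x y w → x * (y * w) ≡ y * (x * w)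
  exchange = solve-∀
  inner : sum (λ z → sum (λ s → L a z * (L b s * adjM L T s z))) ≡ sum (λ s → sum (λ z → L b s * (L a z * adjM L T′ z s)))
  inner = trans (∑-comm (λ z s → L a z * (L b s * adjM L T s z)))
    (sum-cong-≗ λ s → sum-cong-≗ λ z → trans (exchange (L a z) (L b s) _)
      (cong (λ w → L b s * (L a z * w)) (trans (ih s z) (cong (λ X → adjM L X z s) T≡T′))))

adj-sym : {L : Matrix n} → Symmetric L → (S : Subset n) (a b : Fin n) → adjM L S a b ≡ adjM L S b a
adj-sym L-sym S = adj-sym-size L-sym ∣ S ∣ S ℕₚ.≤-refl

AgreeOn : Subset n → Matrix n → Matrix n → Set
AgreeOn S L M = ∀ i j → S ∋ i → S ∋ j → L i j ≡ M i j

AgreeOn-∖ : {S : Subset n} {L M : Matrix n} (a : Fin n) → AgreeOn S L M → AgreeOn (S ∖ a) L M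
AgreeOn-∖ {S = S} a L≈M i j p q = L≈M i j (proj₂ (∖-∋ S p)) (proj₂ (∖-∋ S q))

-- An entry of L with an index outside the current set is always multiplied by an adjugate entry
-- that starts or ends outside that set, and such an adjugate entry is zero.
adjF-cong : {L M : Matrix n} (k : ℕ) (S : Subset n) → AgreeOn S L M → ∀ v u → adjF L k S v u ≡ adjF M k S v u
detF-cong : {L M : Matrix n} (k : ℕ) (S : Subset n) → AgreeOn S L M → detF L k S ≡ detF M k S

adjF-cong zero S L≈M v u = refl
adjF-cong {L = L} {M} (suc k) S L≈M v u with ∋? S v
... | inj₂ p = trans (adjF-out L (suc k) S u p) (sym (adjF-out M (suc k) S u p))
... | inj₁ p = cong (ind (lookup S v) *_)
  (cong₂ (λ a b → δ v u * a - b) (detF-cong k (S ∖ v) L≈M′) (sum-cong-≗ term))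
  where
  L≈M′ : AgreeOn (S ∖ v) L M
  L≈M′ = AgreeOn-∖ {S = S} v L≈M
  term : ∀ z → L v z * adjF L k (S ∖ v) z u ≡ M v z * adjF M k (S ∖ v) z u
  term z with ∋? (S ∖ v) z
  ... | inj₁ q = cong₂ _*_ (L≈M v z p (proj₂ (∖-∋ S q))) (adjF-cong k (S ∖ v) L≈M′ z u)
  ... | inj₂ q = trans (trans (cong (L v z *_) (adjF-out L k (S ∖ v) u q)) (ℤₚ.*-zeroʳ (L v z)))
                  (sym (trans (cong (M v z *_) (adjF-out M k (S ∖ v) u q)) (ℤₚ.*-zeroʳ (M v z))))

detF-cong zero S L≈M = refl
detF-cong {L = L} {M} (suc k) S L≈M = go (adjF-cong (suc k) S L≈M)
  where
  go : (∀ v u → adjF L (suc k) S v u ≡ adjF M (suc k) S v u) → detF L (suc k) S ≡ detF M (suc k) S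
  go adj≈ with first (lookup S) in e
  ... | nothing = refl
  ... | just x = sum-cong-≗ term
    where
    term : ∀ z → L x z * adjF L (suc k) S x z ≡ M x z * adjF M (suc k) S x z
    term z with ∋? S z
    ... | inj₁ q = cong₂ _*_ (L≈M x z (first-just (lookup S) e) q) (adj≈ x z)
    ... | inj₂ q = trans (trans (cong (L x z *_) (adjF-outʳ L (suc k) S x q)) (ℤₚ.*-zeroʳ (L x z)))
                    (sym (trans (cong (M x z *_) (adjF-outʳ M (suc k) S x q)) (ℤₚ.*-zeroʳ (M x z))))

det-cong : {L M : Matrix n} (S : Subset n) → AgreeOn S L M → det L S ≡ det M S
det-cong S = detF-cong ∣ S ∣ S

adj-cong : {L M : Matrix n} (S : Subset n) → AgreeOn S L M → ∀ v u → adjM L S v u ≡ adjM M S v u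
adj-cong S = adjF-cong ∣ S ∣ S

expand-cong : {L M : Matrix n} (S : Subset n) {v : Fin n} → (∀ i j → L i j ≡ M i j) → expand L S v ≡ expand M S v
expand-cong S {v} L≈M = sum-cong-≗ λ z → cong₂ _*_ (L≈M v z) (adj-cong S (λ i j _ _ → L≈M i j) v z)

-- The adjugate identity and independence of the expansion vertex

IsAdjugate : Matrix n → Subset n → Set
IsAdjugate L S = ∀ v c → S ∋ v → S ∋ c → sum (λ u → adjM L S v u * L u c) ≡ δ v c * det L S

-- Kept apart from `IsAdjugate` because `det L S` does not occur in it: it can be known on S before
-- the expansions at different vertices are compared.
OffDiagonalZero : Matrix n → Subset n → Set
OffDiagonalZero L S = ∀ v c → S ∋ v → S ∋ c → v ≢ c → sum (λ u → adjM L S v u * L u c) ≡ + 0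

sum-adj-out : (L : Matrix n) (S : Subset n) {v : Fin n} (f : Fin n → ℤ) → S ∌ v → sum (λ u → adjM L S v u * f u) ≡ + 0
sum-adj-out L S f p = sum-zero λ u → cong (_* f u) (adj-out L S u p)

δ-∌ : (S : Subset n) {z c : Fin n} → S ∌ z → S ∋ c → δ z c ≡ + 0
δ-∌ S p q = δ-≢ λ { refl → ∌-∋ S p q }

-- With D = det(S - v), the trivial path contributes D · L v c. The paths continuing to z contribute
-- -L v z times an entry of adj · L on S - v, which is D for z = c and 0 otherwise, so the two parts
-- cancel. The argument needs c to survive in S - v, hence c ≠ v.
offDiagonal : {L : Matrix n} (S : Subset n) → (∀ v → S ∋ v → IsAdjugate L (S ∖ v)) → OffDiagonalZero L S
offDiagonal {L = L} S ih v c pv pc v≢c = begin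
  sum (λ u → adjM L S v u * L u c)
    ≡⟨ sum-cong-≗ (λ u → trans (cong (_* L u c) (adj-in L S u pv)) (lem (δ v u) D (sum (λ z → L v z * adjM L T z u)) (L u c))) ⟩
  sum (λ u → δ v u * (D * L u c) - sum (λ z → L v z * adjM L T z u) * L u c)
    ≡⟨ sum-sub (λ u → δ v u * (D * L u c)) (λ u → sum (λ z → L v z * adjM L T z u) * L u c) ⟩
  sum (λ u → δ v u * (D * L u c)) - sum (λ u → sum (λ z → L v z * adjM L T z u) * L u c)
    ≡⟨ cong₂ _-_ (sum-δˡ (λ u → D * L u c) v) (sum-assoc (L v) (adjM L T) (λ u → L u c)) ⟩
  D * L v c - sum (λ z → L v z * sum (λ u → adjM L T z u * L u c))
    ≡⟨ cong (λ h → D * L v c - h) (sum-cong-≗ λ z → trans (cong (L v z *_) (inner z)) (lem₂ (L v z) (δ z c) D)) ⟩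
  D * L v c - sum (λ z → (D * L v z) * δ z c)
    ≡⟨ cong (λ h → D * L v c - h) (sum-δʳ (λ z → D * L v z) c) ⟩
  D * L v c - D * L v c ≡⟨ ℤₚ.+-inverseʳ (D * L v c) ⟩
  + 0 ∎
  where
  open ≡-Reasoning
  T = S ∖ v
  D = det L T
  lem : ∀ d D x l → (d * D - x) * l ≡ d * (D * l) - x * l
  lem = solve-∀
  lem₂ : ∀ l d D → l * (d * D) ≡ D * l * d
  lem₂ = solve-∀
  pc′ : T ∋ c
  pc′ = trans (∖-other S (v≢c ∘ sym)) pc
  inner : ∀ z → sum (λ u → adjM L T z u * L u c) ≡ δ z c * D
  inner z with ∋? T z
  ... | inj₁ q = ih v pv z c q pc′
  ... | inj₂ q = trans (sum-adj-out L T (λ u → L u c) q) (sym (cong (_* D) (δ-∌ T q pc′)))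

-- On the diagonal, symmetry of L turns the product into the expansion at c. So adj · L is diagonal
-- on S with the expansions as entries, and it remains to see that these coincide.
adj-row : {L : Matrix n} → Symmetric L → (S : Subset n) → OffDiagonalZero L S → (a c : Fin n) → S ∋ c →
  sum (λ u → adjM L S a u * L u c) ≡ δ a c * expand L S c
adj-row {L = L} L-sym S off a c pc with ∋? S a | toSum (a ≟ c)
... | inj₂ p | _ = trans (sum-adj-out L S (λ u → L u c) p) (sym (cong (_* expand L S c) (δ-∌ S p pc)))
... | inj₁ p | inj₂ a≢c = trans (off a c p pc a≢c) (sym (cong (_* expand L S c) (δ-≢ a≢c)))
... | inj₁ p | inj₁ refl = trans
  (sum-cong-≗ λ u → trans (ℤₚ.*-comm (adjM L S a u) (L u a)) (cong (_* adjM L S a u) (L-sym u a)))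
  (sym (trans (cong (_* expand L S a) (δ-refl a)) (ℤₚ.*-identityˡ _)))

adj-col : {L : Matrix n} → Symmetric L → (S : Subset n) → OffDiagonalZero L S → (v b : Fin n) → S ∋ v →
  sum (λ a → L v a * adjM L S a b) ≡ δ v b * expand L S v
adj-col {L = L} L-sym S off v b pv = trans
  (sum-cong-≗ λ a → trans (ℤₚ.*-comm (L v a) _) (cong₂ _*_ (adj-sym L-sym S a b) (L-sym v a)))
  (trans (adj-row L-sym S off b v pv) (cong (_* expand L S v) (δ-sym b v)))

-- Both sides evaluate the (v , c) entry of L · adj · L.
expand-balance : {L : Matrix n} → Symmetric L → (S : Subset n) → OffDiagonalZero L S → (v c : Fin n) → S ∋ v → S ∋ c →
  L v c * expand L S v ≡ L v c * expand L S c
expand-balance {L = L} L-sym S off v c pv pc = begin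
  L v c * expand L S v
    ≡⟨ sym (sum-δˡ (λ b → L b c * expand L S v) v) ⟩
  sum (λ b → δ v b * (L b c * expand L S v))
    ≡⟨ sum-cong-≗ (λ b → trans (lem (δ v b) (L b c) (expand L S v)) (cong (_* L b c) (sym (adj-col L-sym S off v b pv)))) ⟩
  sum (λ b → sum (λ a → L v a * adjM L S a b) * L b c)
    ≡⟨ sum-assoc (L v) (adjM L S) (λ b → L b c) ⟩
  sum (λ a → L v a * sum (λ b → adjM L S a b * L b c))
    ≡⟨ sum-cong-≗ (λ a → trans (cong (L v a *_) (adj-row L-sym S off a c pc)) (lem₂ (L v a) (δ a c) (expand L S c))) ⟩
  sum (λ a → (L v a * expand L S c) * δ a c)
    ≡⟨ sum-δʳ (λ a → L v a * expand L S c) c ⟩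
  L v c * expand L S c ∎
  where
  open ≡-Reasoning
  lem : ∀ d l e → d * (l * e) ≡ d * e * l
  lem = solve-∀
  lem₂ : ∀ l d e → l * (d * e) ≡ l * e * d
  lem₂ = solve-∀

expand-adjacent : {L : Matrix n} → Symmetric L → (S : Subset n) → OffDiagonalZero L S → (v c : Fin n) → S ∋ v → S ∋ c →
  L v c ≢ + 0 → expand L S v ≡ expand L S c
expand-adjacent {L = L} L-sym S off v c pv pc L≢0 =
  ℤₚ.*-cancelˡ-≡ (L v c) _ _ {{ℤ.≢-nonZero L≢0}} (expand-balance L-sym S off v c pv pc)

-- Isolates the row of v: the minor and the adjugate of S - v do not involve it, so the expansion is
-- affine in L v v and quadratic in the other entries of the row.
expand-twice : (L : Matrix n) (S : Subset n) {v : Fin n} → S ∋ v →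
  expand L S v ≡ L v v * det L (S ∖ v) - sum (λ z → sum (λ s → L v z * (L v s * adjM L (S ∖ v) s z)))
expand-twice L S {v} p = begin
  expand L S v
    ≡⟨ sum-cong-≗ (λ z → trans (cong (L v z *_) (adj-in L S z p))
         (trans (lem (L v z) (δ v z) D (sum (λ s → L v s * X s z)))
                (cong (λ h → δ v z * (L v z * D) - h) (*-distribˡ-sum (L v z) (λ s → L v s * X s z))))) ⟩
  sum (λ z → δ v z * (L v z * D) - sum (λ s → L v z * (L v s * X s z)))
    ≡⟨ sum-sub (λ z → δ v z * (L v z * D)) (λ z → sum (λ s → L v z * (L v s * X s z))) ⟩
  sum (λ z → δ v z * (L v z * D)) - sum (λ z → sum (λ s → L v z * (L v s * X s z)))
    ≡⟨ cong (_- sum (λ z → sum (λ s → L v z * (L v s * X s z)))) (sum-δˡ (λ z → L v z * D) v) ⟩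
  L v v * D - sum (λ z → sum (λ s → L v z * (L v s * X s z))) ∎
  where
  open ≡-Reasoning
  D = det L (S ∖ v)
  X = adjM L (S ∖ v)
  lem : ∀ l d D x → l * (d * D - x) ≡ d * (l * D) - l * x
  lem = solve-∀

sum-quadratic : (t : ℤ) (f g h : Fin n → ℤ) →
  sum (λ i → f i + t * g i + t * t * h i) ≡ sum f + t * sum g + t * t * sum h
sum-quadratic t f g h = trans (∑-distrib-+ (λ i → f i + t * g i) (λ i → t * t * h i))
  (cong₂ _+_ (trans (∑-distrib-+ f (λ i → t * g i)) (cong (_+_ (sum f)) (sym (*-distribˡ-sum t g))))
             (sym (*-distribˡ-sum (t * t) h)))

quadratic : ℤ × ℤ × ℤ → ℤ → ℤ
quadratic (A , B , C) t = A + t * B + t * t * C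

-- The third difference of a quadratic polynomial vanishes, so p(0) = 3 p(1) - 3 p(2) + p(3). Three
-- nonzero arguments thus determine the value at 0 within the integers, without division.
quadratic-const : ∀ p p′ → quadratic p (+ 1) ≡ quadratic p′ (+ 1) → quadratic p (+ 2) ≡ quadratic p′ (+ 2) →
  quadratic p (+ 3) ≡ quadratic p′ (+ 3) → quadratic p (+ 0) ≡ quadratic p′ (+ 0)
quadratic-const (A , B , C) (A′ , B′ , C′) e₁ e₂ e₃ = trans (interpolate A B C)
  (trans (cong₂ (λ a b → a + b) (cong₂ (λ a b → + 3 * a - + 3 * b) e₁ e₂) e₃) (sym (interpolate A′ B′ C′)))
  where
  interpolate : ∀ A B C → A + + 0 * B + + 0 * + 0 * C ≡
    + 3 * (A + + 1 * B + + 1 * + 1 * C) - + 3 * (A + + 2 * B + + 2 * + 2 * C) + (A + + 3 * B + + 3 * + 3 * C)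
  interpolate = solve-∀

-- The coefficients are fixed before t and M, so one polynomial serves all t. Since M is constrained
-- only through the row of v and its values on S - v, the lemma applies at either end of a linked
-- pair; `e v ≡ + 0` keeps the diagonal entry fixed.
expand-quadratic : (L : Matrix n) (S : Subset n) {v : Fin n} → S ∋ v → (e : Fin n → ℤ) → e v ≡ + 0 →
  ∃ λ p → ∀ t (M : Matrix n) → (∀ j → M v j ≡ L v j + t * e j) → AgreeOn (S ∖ v) M L → expand M S v ≡ quadratic p t
expand-quadratic L S {v} pv e ev≡0 = p , eq
  where
  open ≡-Reasoning
  D = det L (S ∖ v)
  X = adjM L (S ∖ v)
  f g h : Fin _ → Fin _ → ℤ
  f z s = L v z * (L v s * X s z)
  g z s = e z * (L v s * X s z) + L v z * (e s * X s z)
  h z s = e z * (e s * X s z)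
  ∑∑ : (Fin _ → Fin _ → ℤ) → ℤ
  ∑∑ F = sum (λ z → sum (F z))
  p = L v v * D - ∑∑ f , - ∑∑ g , - ∑∑ h
  lem : ∀ t a b c d x → (a + t * b) * ((c + t * d) * x) ≡ a * (c * x) + t * (b * (c * x) + a * (d * x)) + t * t * (b * (d * x))
  lem = solve-∀
  lem₂ : ∀ t A B C l d → (l + t * + 0) * d - (A + t * B + t * t * C) ≡ l * d - A + t * - B + t * t * - C
  lem₂ = solve-∀
  eq : ∀ t M → (∀ j → M v j ≡ L v j + t * e j) → AgreeOn (S ∖ v) M L → expand M S v ≡ quadratic p t
  eq t M row M≈L = begin
    expand M S v ≡⟨ expand-twice M S pv ⟩
    M v v * det M (S ∖ v) - ∑∑ (λ z s → M v z * (M v s * adjM M (S ∖ v) s z))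
      ≡⟨ cong₂ _-_ (cong₂ _*_ (trans (row v) (cong (λ a → L v v + t * a) ev≡0)) (det-cong (S ∖ v) M≈L))
           (sum-cong-≗ λ z → trans (sum-cong-≗ λ s → trans
                 (cong₂ _*_ (row z) (cong₂ _*_ (row s) (adj-cong (S ∖ v) M≈L s z)))
                 (lem t (L v z) (e z) (L v s) (e s) (X s z)))
               (sum-quadratic t (f z) (g z) (h z))) ⟩
    (L v v + t * + 0) * D - sum (λ z → sum (f z) + t * sum (g z) + t * t * sum (h z))
      ≡⟨ cong (λ a → (L v v + t * + 0) * D - a) (sum-quadratic t (sum ∘ f) (sum ∘ g) (sum ∘ h)) ⟩
    (L v v + t * + 0) * D - (∑∑ f + t * ∑∑ g + t * t * ∑∑ h)
      ≡⟨ lem₂ t (∑∑ f) (∑∑ g) (∑∑ h) (L v v) D ⟩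
    quadratic p t ∎

link : Matrix n → Fin n → Fin n → ℤ → Matrix n
link L v u t i j = L i j + t * (δ i v * δ j u + δ i u * δ j v)

link-sym : {L : Matrix n} → Symmetric L → (v u : Fin n) (t : ℤ) → Symmetric (link L v u t)
link-sym L-sym v u t i j = cong₂ (λ a b → a + t * b) (L-sym i j) (lem (δ i v) (δ j u) (δ i u) (δ j v))
  where
  lem : ∀ a b c d → a * b + c * d ≡ d * c + b * a
  lem = solve-∀

link-swap : (L : Matrix n) (v u : Fin n) (t : ℤ) → ∀ i j → link L v u t i j ≡ link L u v t i j
link-swap L v u t i j = cong (λ b → L i j + t * b) (ℤₚ.+-comm (δ i v * δ j u) _)

link-row : (L : Matrix n) {v u : Fin n} → v ≢ u → ∀ t j → link L v u t v j ≡ L v j + t * δ j u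
link-row L {v} {u} v≢u t j = cong (λ b → L v j + t * b)
  (trans (cong₂ (λ a b → a * δ j u + b * δ j v) (δ-refl v) (δ-≢ v≢u)) (lem (δ j u) (δ j v)))
  where
  lem : ∀ a b → + 1 * a + + 0 * b ≡ a
  lem = solve-∀

link-agree : (L : Matrix n) (S : Subset n) (v u : Fin n) (t : ℤ) → AgreeOn (S ∖ v) (link L v u t) L
link-agree L S v u t i j pi pj = trans
  (cong₂ (λ a b → L i j + t * (a * δ j u + δ i u * b)) (δ-≢ (proj₁ (∖-∋ S pi))) (δ-≢ (proj₁ (∖-∋ S pj))))
  (lem (L i j) t (δ j u) (δ i u))
  where
  lem : ∀ l t a b → l + t * (+ 0 * a + b * + 0) ≡ l
  lem = solve-∀

-- If L v u = 0, link v and u by an entry t.  Both expansions are quadratic in t and agree for t ≠ 0.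
expand-unique : (S : Subset n) → (∀ L → Symmetric L → OffDiagonalZero L S) →
  {L : Matrix n} → Symmetric L → (v u : Fin n) → S ∋ v → S ∋ u → expand L S v ≡ expand L S u
expand-unique S off {L} L-sym v u pv pu with v ≟ u | L v u ℤ.≟ + 0
... | yes refl | _ = refl
... | no _ | no L≢0 = expand-adjacent L-sym S (off L L-sym) v u pv pu L≢0
... | no v≢u | yes L≡0 = begin
  expand L S v ≡⟨ expand-cong S unlinked ⟩
  expand (link L v u (+ 0)) S v ≡⟨ at-v (+ 0) ⟩
  quadratic p (+ 0) ≡⟨ quadratic-const p p′ (agree (+ 1) λ ()) (agree (+ 2) λ ()) (agree (+ 3) λ ()) ⟩
  quadratic p′ (+ 0) ≡⟨ sym (at-u (+ 0)) ⟩
  expand (link L v u (+ 0)) S u ≡⟨ sym (expand-cong S unlinked) ⟩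
  expand L S u ∎
  where
  open ≡-Reasoning
  qv = expand-quadratic L S pv (λ j → δ j u) (δ-≢ v≢u)
  qu = expand-quadratic L S pu (λ j → δ j v) (δ-≢ (v≢u ∘ sym))
  p = proj₁ qv
  p′ = proj₁ qu
  at-v : ∀ t → expand (link L v u t) S v ≡ quadratic p t
  at-v t = proj₂ qv t (link L v u t) (link-row L v≢u t) (link-agree L S v u t)
  at-u : ∀ t → expand (link L v u t) S u ≡ quadratic p′ t
  at-u t = trans (expand-cong S (link-swap L v u t))
    (proj₂ qu t (link L u v t) (link-row L (v≢u ∘ sym) t) (link-agree L S u v t))
  unlinked : ∀ i j → L i j ≡ link L v u (+ 0) i j
  unlinked i j = sym (ℤₚ.+-identityʳ (L i j))
  entry : ∀ t → link L v u t v u ≡ t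
  entry t = trans (link-row L v≢u t u) (trans (cong₂ (λ a b → a + t * b) L≡0 (δ-refl u)) (lem t))
    where
    lem : ∀ t → + 0 + t * + 1 ≡ t
    lem = solve-∀
  agree : ∀ t → t ≢ + 0 → quadratic p t ≡ quadratic p′ t
  agree t t≢0 = trans (sym (at-v t)) (trans
    -- The hypothesis `off` is applied to the linked matrix rather than to L, which is why it ranges
    -- over all symmetric matrices.
    (expand-adjacent (link-sym L-sym v u t) S (off _ (link-sym L-sym v u t)) v u pv pu (t≢0 ∘ trans (sym (entry t))))
    (at-u t))

det-expand-off : (S : Subset n) → (∀ L → Symmetric L → OffDiagonalZero L S) →
  {L : Matrix n} → Symmetric L → (v : Fin n) → S ∋ v →
  det L S ≡ expand L S v
det-expand-off S off {L} L-sym v pv with first (lookup S) in e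
... | nothing = ∌-∋ S (first-nothing (lookup S) e v) pv
... | just x = trans (det-first L S e) (expand-unique S off L-sym x v (first-just (lookup S) e) pv)

-- The two statements alternate: vanishing off the diagonal on S rests on the full identity for the
-- sets S - v, and the full identity on S rests on vanishing off the diagonal on the same S, for
-- every symmetric matrix. Only the first step lowers k.
offDiagonal-size : (k : ℕ) (S : Subset n) → ∣ S ∣ ℕ.≤ k → ∀ L → Symmetric L → OffDiagonalZero L S
adjugate-size : (k : ℕ) (S : Subset n) → ∣ S ∣ ℕ.≤ k → ∀ L → Symmetric L → IsAdjugate L S

offDiagonal-size zero S le L L-sym v c pv = ∌-∋ S (∣∣≤0 S le v) pv
offDiagonal-size (suc k) S le L L-sym = offDiagonal S λ v pv → adjugate-size k (S ∖ v) (∣∖∣-pred S v pv le) L L-sym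

adjugate-size k S le L L-sym v c pv pc = trans
  (adj-row L-sym S (offDiagonal-size k S le L L-sym) v c pc)
  (cong (δ v c *_) (sym (det-expand-off S (offDiagonal-size k S le) L-sym c pc)))

offDiagonalZero : (S : Subset n) → ∀ L → Symmetric L → OffDiagonalZero L S
offDiagonalZero S = offDiagonal-size ∣ S ∣ S ℕₚ.≤-refl

det-expand : {L : Matrix n} → Symmetric L → (S : Subset n) (v : Fin n) → S ∋ v → det L S ≡ expand L S v
det-expand L-sym S v pv = det-expand-off S (offDiagonalZero S) L-sym v pv

L·adj : {L : Matrix n} → Symmetric L → (S : Subset n) (v c : Fin n) → S ∋ v →
  sum (λ u → L v u * adjM L S u c) ≡ δ v c * det L S
L·adj {L = L} L-sym S v c pv = trans (adj-col L-sym S (offDiagonalZero S L L-sym) v c pv)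
  (cong (δ v c *_) (sym (det-expand L-sym S v pv)))

-- By `expand-twice` the minor is affine in the entry at (a , a), with slope det(S - a). This is
-- deletion-contraction on the side of determinants: an edge from a to the root raises that entry by
-- 1.
det-diagonal-step : {L M : Matrix n} → Symmetric L → Symmetric M → (S : Subset n) (a : Fin n) → S ∋ a →
  AgreeOn S M (λ i j → L i j + δ i a * δ j a) → det M S ≡ det L (S ∖ a) + det L S
det-diagonal-step {L = L} {M} L-sym M-sym S a pa M≈ = begin
  det M S ≡⟨ det-expand M-sym S a pa ⟩
  expand M S a ≡⟨ expand-twice M S pa ⟩
  M a a * det M (S ∖ a) - sum (λ z → sum (λ s → M a z * (M a s * adjM M (S ∖ a) s z)))
    ≡⟨ cong₂ _-_ (cong₂ _*_ (trans (M≈ a a pa pa) (cong (λ d → L a a + d * d) (δ-refl a))) (det-cong (S ∖ a) M≈L))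
        (sum-cong-≗ λ z → sum-cong-≗ λ s → term z s) ⟩
  (L a a + + 1 * + 1) * det L (S ∖ a) - sum (λ z → sum (λ s → L a z * (L a s * adjM L (S ∖ a) s z)))
    ≡⟨ lem (L a a) (det L (S ∖ a)) _ ⟩
  det L (S ∖ a) + (L a a * det L (S ∖ a) - sum (λ z → sum (λ s → L a z * (L a s * adjM L (S ∖ a) s z))))
    ≡⟨ cong (_+_ (det L (S ∖ a))) (sym (trans (det-expand L-sym S a pa) (expand-twice L S pa))) ⟩
  det L (S ∖ a) + det L S ∎
  where
  open ≡-Reasoning
  lem : ∀ l d x → (l + + 1 * + 1) * d - x ≡ d + (l * d - x)
  lem = solve-∀
  entry : ∀ i j → S ∋ i → S ∖ a ∋ j → M i j ≡ L i j
  entry i j pi pj = trans (M≈ i j pi (proj₂ (∖-∋ S pj)))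
    (trans (cong (λ d → L i j + δ i a * d) (δ-≢ (proj₁ (∖-∋ S pj))))
      (trans (cong (_+_ (L i j)) (ℤₚ.*-zeroʳ (δ i a))) (ℤₚ.+-identityʳ (L i j))))
  M≈L : AgreeOn (S ∖ a) M L
  M≈L i j pi pj = entry i j (proj₂ (∖-∋ S pi)) pj
  term : ∀ z s → M a z * (M a s * adjM M (S ∖ a) s z) ≡ L a z * (L a s * adjM L (S ∖ a) s z)
  term z s with ∋? (S ∖ a) z | ∋? (S ∖ a) s
  ... | inj₁ pz | inj₁ ps = cong₂ _*_ (entry a z pa pz) (cong₂ _*_ (entry a s pa ps) (adj-cong (S ∖ a) M≈L s z))
  ... | inj₂ qz | _ = trans (vanish M (adj-zeroʳ M (S ∖ a) s qz)) (sym (vanish L (adj-zeroʳ L (S ∖ a) s qz)))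
    where
    vanish : ∀ N → adjM N (S ∖ a) s z ≡ + 0 → N a z * (N a s * adjM N (S ∖ a) s z) ≡ + 0
    vanish N e rewrite e | ℤₚ.*-zeroʳ (N a s) = ℤₚ.*-zeroʳ (N a z)
  ... | inj₁ _ | inj₂ qs = trans (vanish M (adj-out M (S ∖ a) z qs)) (sym (vanish L (adj-out L (S ∖ a) z qs)))
    where
    vanish : ∀ N → adjM N (S ∖ a) s z ≡ + 0 → N a z * (N a s * adjM N (S ∖ a) s z) ≡ + 0
    vanish N e rewrite e | ℤₚ.*-zeroʳ (N a s) = ℤₚ.*-zeroʳ (N a z)

-- Multiply 1_S · L = 0 on the right by adj: the result is det times 1_S, and its entry at u ∈ S is
-- the determinant itself.
det-singular : {L : Matrix n} → Symmetric L → (S : Subset n) {u : Fin n} → S ∋ u →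
  (∀ c → S ∋ c → sum (λ v → ind (lookup S v) * L v c) ≡ + 0) → det L S ≡ + 0
det-singular {L = L} L-sym S {u} pu colsum = begin
  det L S ≡⟨ sym (ℤₚ.*-identityˡ (det L S)) ⟩
  + 1 * det L S ≡⟨ cong (λ b → ind b * det L S) (sym pu) ⟩
  ind (lookup S u) * det L S ≡⟨ sym (sum-δʳ (λ v → ind (lookup S v) * det L S) u) ⟩
  sum (λ v → ind (lookup S v) * det L S * δ v u) ≡⟨ sum-cong-≗ row ⟩
  sum (λ v → ind (lookup S v) * sum (λ c → L v c * adjM L S c u))
    ≡⟨ sym (sum-assoc (λ v → ind (lookup S v)) L (λ c → adjM L S c u)) ⟩
  sum (λ c → sum (λ v → ind (lookup S v) * L v c) * adjM L S c u) ≡⟨ sum-zero col ⟩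
  + 0 ∎
  where
  open ≡-Reasoning
  row : ∀ v → ind (lookup S v) * det L S * δ v u ≡ ind (lookup S v) * sum (λ c → L v c * adjM L S c u)
  row v with ∋? S v
  ... | inj₂ q rewrite q = refl
  ... | inj₁ p = trans (lem (ind (lookup S v)) (det L S) (δ v u)) (cong (ind (lookup S v) *_) (sym (L·adj L-sym S v u p)))
    where
    lem : ∀ i d e → i * d * e ≡ i * (e * d)
    lem = solve-∀
  col : ∀ c → sum (λ v → ind (lookup S v) * L v c) * adjM L S c u ≡ + 0
  col c with ∋? S c
  ... | inj₁ p = cong (_* adjM L S c u) (colsum c p)
  ... | inj₂ q = trans (cong (sum (λ v → ind (lookup S v) * L v c) *_) (adj-out L S u q)) (ℤₚ.*-zeroʳ (sum (λ v → ind (lookup S v) * L v c)))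

-- Reachability and counting sublists

Edges : ℕ → Set
Edges n = List (Fin n × Fin n)

bool-ext : {p q : Bool} → (p ≡ true → q ≡ true) → (q ≡ true → p ≡ true) → p ≡ q
bool-ext {false} {false} f g = refl
bool-ext {false} {true}  f g = g refl
bool-ext {true}  {false} f g = sym (f refl)
bool-ext {true}  {true}  f g = refl

∧-true : {p q : Bool} → p ∧ q ≡ true → p ≡ true × q ≡ true
∧-true {true} {true} e = refl , refl

∨-true : {p q : Bool} → p ∨ q ≡ true → p ≡ true ⊎ q ≡ true
∨-true {true} e = inj₁ refl
∨-true {false} e = inj₂ e

∨-introʳ : (p : Bool) {q : Bool} → q ≡ true → p ∨ q ≡ true
∨-introʳ false e = e
∨-introʳ true  e = refl

∨-introˡ : {p : Bool} (q : Bool) → p ≡ true → p ∨ q ≡ true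
∨-introˡ q refl = refl

≢true : {p : Bool} → p ≢ true → p ≡ false
≢true = Boolₚ.¬-not

-- The fold inside `connectedB`, in the same shape, so that the two match definitionally.
allB : (Fin n → Bool) → Bool
allB {n} f = foldr (λ v acc → acc ∧ f v) true (allFin n)

private
  foldr-map-suc : (f : Fin (suc n) → Bool) (vs : List (Fin n)) →
    foldr (λ v acc → acc ∧ f v) true (map suc vs) ≡ foldr (λ v acc → acc ∧ f (suc v)) true vs
  foldr-map-suc f [] = refl
  foldr-map-suc f (v ∷ vs) = cong (_∧ f (suc v)) (foldr-map-suc f vs)

allB-sound : (f : Fin n → Bool) → allB f ≡ true → ∀ v → f v ≡ true
allB-sound f e zero = proj₂ (∧-true e)
allB-sound {suc n} f e (suc v) =
  allB-sound (f ∘ suc) (trans (sym (foldr-map-suc f (allFin n))) (proj₁ (∧-true e))) v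

allB-complete : (f : Fin n → Bool) → (∀ v → f v ≡ true) → allB f ≡ true
allB-complete {zero} f h = refl
allB-complete {suc n} f h = cong₂ _∧_ (trans (foldr-map-suc f (allFin n)) (allB-complete (f ∘ suc) (h ∘ suc))) (h zero)

-- The walk may start anywhere in `B`. With the complement of S as `B`, this is connection to the
-- vertex obtained by merging that complement, while all vertices keep their names.
data Reach (B : VSet n) (T : Edges n) : Fin n → Set where
  base : ∀ {v} → B v ≡ true → Reach B T v
  fwd  : ∀ {u v} → Reach B T u → (u , v) ∈ T → Reach B T v
  bwd  : ∀ {u v} → Reach B T u → (v , u) ∈ T → Reach B T v

Reach-map : {B B′ : VSet n} {T T′ : Edges n} → (∀ {v} → B v ≡ true → Reach B′ T′ v) →
  (∀ {u v} → (u , v) ∈ T → (Reach B′ T′ u → Reach B′ T′ v) × (Reach B′ T′ v → Reach B′ T′ u)) →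
  ∀ {v} → Reach B T v → Reach B′ T′ v
Reach-map f g (base p) = f p
Reach-map f g (fwd r m) = proj₁ (g m) (Reach-map f g r)
Reach-map f g (bwd r m) = proj₂ (g m) (Reach-map f g r)

Reach-mono : {B B′ : VSet n} {T T′ : Edges n} → (∀ {v} → B v ≡ true → Reach B′ T′ v) → (∀ {e} → e ∈ T → e ∈ T′) →
  ∀ {v} → Reach B T v → Reach B′ T′ v
Reach-mono f g = Reach-map f λ m → (λ r → fwd r (g m)) , (λ r → bwd r (g m))

grow-keep : (T : Edges n) (X : VSet n) {v : Fin n} → X v ≡ true → grow T X v ≡ true
grow-keep T X {v} p = ∨-introˡ _ p

private
  hit : VSet n → Fin n → Fin n × Fin n → Bool
  hit X v e = (X (proj₁ e) ∧ (v == proj₂ e)) ∨ (X (proj₂ e) ∧ (v == proj₁ e))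

  hits : Edges n → VSet n → Fin n → Bool
  hits T X v = foldr (λ e acc → acc ∨ hit X v e) false T

  hits-complete : (T : Edges n) (X : VSet n) {v : Fin n} {e : Fin n × Fin n} → e ∈ T → hit X v e ≡ true → hits T X v ≡ true
  hits-complete (e ∷ T) X (here refl) h = ∨-introʳ (hits T X _) h
  hits-complete (e ∷ T) X (there m) h = ∨-introˡ _ (hits-complete T X m h)

  hits-sound : (T : Edges n) (X : VSet n) {v : Fin n} → hits T X v ≡ true → ∃ λ e → e ∈ T × hit X v e ≡ true
  hits-sound (e ∷ T) X {v} h with ∨-true {hits T X v} h
  ... | inj₂ q = e , here refl , q
  ... | inj₁ q with hits-sound T X q
  ...   | e′ , m , r = e′ , there m , r

grow-fwd : (T : Edges n) (X : VSet n) {u v : Fin n} → X u ≡ true → (u , v) ∈ T → grow T X v ≡ true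
grow-fwd T X {u} {v} p m = ∨-introʳ (X v) (hits-complete T X m (∨-introˡ _ (cong₂ _∧_ p (==-refl v))))

grow-bwd : (T : Edges n) (X : VSet n) {u v : Fin n} → X u ≡ true → (v , u) ∈ T → grow T X v ≡ true
grow-bwd T X {u} {v} p m = ∨-introʳ (X v) (hits-complete T X m (∨-introʳ (X v ∧ (v == u)) (cong₂ _∧_ p (==-refl v))))

grow-sound : (T : Edges n) (X : VSet n) {v : Fin n} → grow T X v ≡ true →
  X v ≡ true ⊎ (∃ λ u → X u ≡ true × ((u , v) ∈ T ⊎ (v , u) ∈ T))
grow-sound T X {v} h with ∨-true {X v} h
... | inj₁ q = inj₁ q
... | inj₂ q with hits-sound T X q
...   | (a , b) , m , r with ∨-true {X a ∧ (v == b)} r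
...     | inj₁ s = inj₂ (a , proj₁ (∧-true s) , inj₁ (subst (λ b → (a , b) ∈ T) (sym (==-sound (proj₂ (∧-true {X a} s)))) m))
...     | inj₂ s = inj₂ (b , proj₁ (∧-true s) , inj₂ (subst (λ a → (a , b) ∈ T) (sym (==-sound (proj₂ (∧-true {X b} s)))) m))

Closed : Edges n → VSet n → Set
Closed T X = ∀ v → grow T X v ≡ true → X v ≡ true

grow-closed : (T : Edges n) (X : VSet n) → Closed T X → Closed T (grow T X)
grow-closed T X c v h with grow-sound T (grow T X) h
... | inj₁ q = q
... | inj₂ (u , p , inj₁ m) = grow-fwd T X (c u p) m
... | inj₂ (u , p , inj₂ m) = grow-bwd T X (c u p) m

⊆-size : (S T : Subset n) → (∀ v → S ∋ v → T ∋ v) → ∣ S ∣ ℕ.≤ ∣ T ∣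
⊆-size [] [] h = ℕ.z≤n
⊆-size (false ∷ S) (false ∷ T) h = ⊆-size S T (h ∘ suc)
⊆-size (false ∷ S) (true ∷ T) h = ℕₚ.m≤n⇒m≤1+n (⊆-size S T (h ∘ suc))
⊆-size (true ∷ S) (true ∷ T) h = ℕ.s≤s (⊆-size S T (h ∘ suc))
⊆-size (true ∷ S) (false ∷ T) h = case h zero refl of λ ()

size-grow : {X Y : VSet n} → (∀ v → X v ≡ true → Y v ≡ true) → (v : Fin n) → Y v ≡ true → X v ≡ false →
  suc ∣ tabulate X ∣ ℕ.≤ ∣ tabulate Y ∣
size-grow {X = X} {Y} X⊆Y v p q = subst (suc ∣ tabulate X ∣ ℕ.≤_) (sym (∣∖∣ (tabulate Y) v (trans (Vecₚ.lookup∘tabulate Y v) p)))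
  (ℕ.s≤s (⊆-size (tabulate X) (tabulate Y ∖ v) λ u pu →
    let Xu = trans (sym (Vecₚ.lookup∘tabulate X u)) pu in
    trans (∖-other (tabulate Y) λ { refl → case trans (sym q) Xu of λ () })
          (trans (Vecₚ.lookup∘tabulate Y u) (X⊆Y u Xu))))

closed? : (T : Edges n) (X : VSet n) → Closed T X ⊎ (∃ λ v → grow T X v ≡ true × X v ≡ false)
closed? T X with first (λ v → grow T X v ∧ not (X v)) in e
... | nothing = inj₁ λ v g → case ∋? (tabulate X) v of λ where
  (inj₁ p) → trans (sym (Vecₚ.lookup∘tabulate X v)) p
  (inj₂ p) → case trans (sym (first-nothing _ e v)) (cong₂ (λ a b → a ∧ not b) g (trans (sym (Vecₚ.lookup∘tabulate X v)) p)) of λ ()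
... | just v with ∧-true (first-just _ e)
...   | p , q = inj₂ (v , p , trans (sym (Boolₚ.not-involutive (X v))) (cong not q))

-- A round that starts from a set not yet closed adds a vertex. After n rounds the set is therefore
-- closed or has n elements, and in the second case it is everything.
iter-closed : (T : Edges n) (B : VSet n) → Closed T (iter n (grow T) B)
iter-closed {n} T B with progress n
  where
  progress : ∀ k → Closed T (iter k (grow T) B) ⊎ k ℕ.≤ ∣ tabulate (iter k (grow T) B) ∣
  progress zero = inj₂ ℕ.z≤n
  progress (suc k) with progress k | closed? T (iter k (grow T) B)
  ... | inj₁ c | _ = inj₁ (grow-closed T _ c)
  ... | inj₂ _ | inj₁ c = inj₁ (grow-closed T _ c)
  ... | inj₂ le | inj₂ (v , p , q) = inj₂ (ℕₚ.≤-trans (ℕ.s≤s le) (size-grow (λ u → grow-keep T (iter k (grow T) B) {u}) v p q))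
... | inj₁ c = c
... | inj₂ le = λ v _ → trans (sym (Vecₚ.lookup∘tabulate X v)) (trans (cong (λ S → lookup S v) all) (Vecₚ.lookup-replicate v true))
  where
  X = iter n (grow T) B
  all : tabulate X ≡ ⊤ₛ
  all = Subsetₚ.∣p∣≡n⇒p≡⊤ (ℕₚ.≤-antisym (Subsetₚ.∣p∣≤n (tabulate X)) le)

iter-keep : (T : Edges n) (B : VSet n) (k : ℕ) {v : Fin n} → B v ≡ true → iter k (grow T) B v ≡ true
iter-keep T B zero p = p
iter-keep T B (suc k) p = grow-keep T (iter k (grow T) B) (iter-keep T B k p)

reach-complete : (T : Edges n) (B : VSet n) {v : Fin n} → Reach B T v → iter n (grow T) B v ≡ true
reach-complete {n} T B (base p) = iter-keep T B n p
reach-complete T B (fwd r m) = iter-closed T B _ (grow-fwd T _ (reach-complete T B r) m)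
reach-complete T B (bwd r m) = iter-closed T B _ (grow-bwd T _ (reach-complete T B r) m)

reach-sound : (T : Edges n) (B : VSet n) (k : ℕ) {v : Fin n} → iter k (grow T) B v ≡ true → Reach B T v
reach-sound T B zero p = base p
reach-sound T B (suc k) p with grow-sound T (iter k (grow T) B) p
... | inj₁ q = reach-sound T B k q
... | inj₂ (u , q , inj₁ m) = fwd (reach-sound T B k q) m
... | inj₂ (u , q , inj₂ m) = bwd (reach-sound T B k q) m

-- Sublists are counted by position, as in `τ`, so parallel edges stay distinct. Splitting by
-- whether the head is chosen is already the split of deletion-contraction.
countSub : (List A → Bool) → List A → ℕ
countSub p []       = if p [] then 1 else 0
countSub p (e ∷ es) = countSub (p ∘ (e ∷_)) es ℕ.+ countSub p es

-- A property of the listed elements passes to all sublists, so predicates that agree only for edges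
-- inside a given vertex set can be exchanged.
countSub-cong : {P : A → Set} {p q : List A → Bool} {es : List A} → All P es → (∀ T → All P T → p T ≡ q T) →
  countSub p es ≡ countSub q es
countSub-cong [] h = cong (λ b → if b then 1 else 0) (h [] [])
countSub-cong (pe ∷ pes) h = cong₂ ℕ._+_ (countSub-cong pes λ T pT → h _ (pe ∷ pT)) (countSub-cong pes h)

countSub-≗ : {p q : List A → Bool} (es : List A) → (∀ T → p T ≡ q T) → countSub p es ≡ countSub q es
countSub-≗ es h = countSub-cong {P = λ _ → ⊤} (All.universal (λ _ → tt) es) λ T _ → h T

countSub-const-false : (es : List A) → countSub (λ _ → false) es ≡ 0
countSub-const-false [] = refl
countSub-const-false (e ∷ es) = cong₂ ℕ._+_ (countSub-const-false es) (countSub-const-false es)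

countSub-zero : {p : List A → Bool} (es : List A) → (∀ T → p T ≡ false) → countSub p es ≡ 0
countSub-zero es h = trans (countSub-≗ es h) (countSub-const-false es)

-- Serves to bring an edge at the root to the head of the list, where `countSub` splits on it.
countSub-↭ : {p : List A → Bool} {es es′ : List A} → (∀ {T T′} → T ↭ T′ → p T ≡ p T′) → es ↭ es′ → countSub p es ≡ countSub p es′
countSub-↭ h refl = refl
countSub-↭ h (prep x r) = cong₂ ℕ._+_ (countSub-↭ (λ s → h (prep x s)) r) (countSub-↭ h r)
countSub-↭ {p = p} {x ∷ y ∷ es} {y ∷ x ∷ es′} h (swap x y r) = trans
  (cong₂ ℕ._+_
    (cong₂ ℕ._+_ (trans (countSub-≗ es λ T → h (swap x y refl)) (countSub-↭ (λ s → h (prep y (prep x s))) r))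
                 (countSub-↭ (λ s → h (prep x s)) r))
    (cong₂ ℕ._+_ (countSub-↭ (λ s → h (prep y s)) r) (countSub-↭ h r)))
  (interchange (countSub (p ∘ (y ∷_) ∘ (x ∷_)) es′) (countSub (p ∘ (x ∷_)) es′) (countSub (p ∘ (y ∷_)) es′) (countSub p es′))
  where
  interchange : ∀ a b c d → a ℕ.+ b ℕ.+ (c ℕ.+ d) ≡ a ℕ.+ c ℕ.+ (b ℕ.+ d)
  interchange = solve-∀ℕ
countSub-↭ h (↭-chain r s) = trans (countSub-↭ h r) (countSub-↭ h s)

private
  length-filter-pairs : ∀ {m} (p : Vec Bool (suc m) → Bool) (xs : List (Vec Bool m)) →
    length (filter (λ s → p s Data.Bool.≟ true) (concatMap (λ s → (true ∷ s) ∷ (false ∷ s) ∷ []) xs)) ≡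
    length (filter (λ s → p (true ∷ s) Data.Bool.≟ true) xs) ℕ.+ length (filter (λ s → p (false ∷ s) Data.Bool.≟ true) xs)
  length-filter-pairs p [] = refl
  length-filter-pairs p (x ∷ xs) with p (true ∷ x)
  ... | true with p (false ∷ x)
  ...   | true  = cong suc (trans (cong suc (length-filter-pairs p xs)) (sym (ℕₚ.+-suc _ _)))
  ...   | false = cong suc (length-filter-pairs p xs)
  length-filter-pairs p (x ∷ xs) | false with p (false ∷ x)
  ...   | true  = trans (cong suc (length-filter-pairs p xs)) (sym (ℕₚ.+-suc _ _))
  ...   | false = length-filter-pairs p xs

countSub-subsets : (p : List A → Bool) (es : List A) →
  length (filter (λ s → p (selected es s) Data.Bool.≟ true) (allSubsets (length es))) ≡ countSub p es
countSub-subsets p [] with p []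
... | true = refl
... | false = refl
countSub-subsets p (e ∷ es) = trans (length-filter-pairs (p ∘ selected (e ∷ es)) (allSubsets (length es)))
  (cong₂ ℕ._+_ (countSub-subsets (p ∘ (e ∷_)) es) (countSub-subsets p es))

-- The matrix-tree theorem

-- The rank-one matrix of the vector e_a - e_b: it is independent of the orientation of the edge,
-- and it is zero for a loop.
edgeForm : Fin n × Fin n → Matrix n
edgeForm (a , b) i j = (δ a i - δ b i) * (δ a j - δ b j)

laplacian : Edges n → Matrix n
laplacian []       i j = + 0
laplacian (e ∷ es) i j = edgeForm e i j + laplacian es i j

laplacian-sym : (es : Edges n) → Symmetric (laplacian es)
laplacian-sym [] i j = refl
laplacian-sym ((a , b) ∷ es) i j = cong₂ _+_ (ℤₚ.*-comm (δ a i - δ b i) (δ a j - δ b j)) (laplacian-sym es i j)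

laplacian-↭ : {es es′ : Edges n} → es ↭ es′ → ∀ i j → laplacian es i j ≡ laplacian es′ i j
laplacian-↭ refl i j = refl
laplacian-↭ (prep e r) i j = cong (_+_ (edgeForm e i j)) (laplacian-↭ r i j)
laplacian-↭ {es = _ ∷ _ ∷ es} {_ ∷ _ ∷ es′} (swap e f r) i j = trans
  (cong (λ l → edgeForm e i j + (edgeForm f i j + l)) (laplacian-↭ r i j))
  (lem (edgeForm e i j) (edgeForm f i j) (laplacian es′ i j))
  where
  lem : ∀ a b c → a + (b + c) ≡ b + (a + c)
  lem = solve-∀
laplacian-↭ (↭-chain r s) i j = trans (laplacian-↭ r i j) (laplacian-↭ s i j)

-- The complement of S plays the role of a single root vertex.
Spans : Subset n → Edges n → Set
Spans S T = ∀ v → Reach (not ∘ lookup S) T v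

spansB : Subset n → Edges n → Bool
spansB {n} S T = allB (iter n (grow T) (not ∘ lookup S))

spansB-sound : (S : Subset n) (T : Edges n) → spansB S T ≡ true → Spans S T
spansB-sound {n} S T e v = reach-sound T (not ∘ lookup S) n (allB-sound _ e v)

spansB-complete : (S : Subset n) (T : Edges n) → Spans S T → spansB S T ≡ true
spansB-complete {n} S T h = allB-complete (iter n (grow T) (not ∘ lookup S)) λ v → reach-complete T (not ∘ lookup S) (h v)

spansB-ext : (S S′ : Subset n) (T T′ : Edges n) → (Spans S T → Spans S′ T′) → (Spans S′ T′ → Spans S T) → spansB S T ≡ spansB S′ T′
spansB-ext S S′ T T′ f g = bool-ext
  (spansB-complete S′ T′ ∘ f ∘ spansB-sound S T) (spansB-complete S T ∘ g ∘ spansB-sound S′ T′)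

spansB-false : (S : Subset n) (T : Edges n) → ¬ Spans S T → spansB S T ≡ false
spansB-false S T h = ≢true (h ∘ spansB-sound S T)

root : (S : Subset n) {T : Edges n} {v : Fin n} → S ∌ v → Reach (not ∘ lookup S) T v
root S p = base (cong not p)

unroot : (S : Subset n) {v : Fin n} → not (lookup S v) ≡ true → S ∌ v
unroot S {v} e = trans (sym (Boolₚ.not-involutive (lookup S v))) (cong not e)

sizeIs : ℕ → List A → Bool
sizeIs k T = ⌊ length T ℕₚ.≟ k ⌋

sizeIs-suc : (k : ℕ) (e : A) (T : List A) → sizeIs (suc k) (e ∷ T) ≡ sizeIs k T
sizeIs-suc k e T = trans (isYes≗does (suc (length T) ℕₚ.≟ suc k)) (sym (isYes≗does (length T ℕₚ.≟ k)))

-- For k = `∣ S ∣` these are the spanning trees of the multigraph on S and one root vertex that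
-- replaces the complement of S.
forests : ℕ → Subset n → Edges n → ℕ
forests k S = countSub (λ T → sizeIs k T ∧ spansB S T)

forests-↭ : (k : ℕ) (S : Subset n) {es es′ : Edges n} → es ↭ es′ → forests k S es ≡ forests k S es′
forests-↭ k S = countSub-↭ λ {T} {T′} r → cong₂ _∧_
  (cong (λ l → ⌊ l ℕₚ.≟ k ⌋) (↭-length r))
  (spansB-ext S S T T′ (λ h v → Reach-mono base (∈-resp-↭ r) (h v))
                       (λ h v → Reach-mono base (∈-resp-↭ (↭-sym r)) (h v)))

forests-0 : (S : Subset n) (e : Fin n × Fin n) (es : Edges n) → forests 0 S (e ∷ es) ≡ forests 0 S es
forests-0 S e es = cong (ℕ._+ forests 0 S es) (countSub-zero es λ T → refl)

forests-suc : (k : ℕ) (S S′ : Subset n) (e : Fin n × Fin n) (es : Edges n) →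
  (∀ T → Spans S (e ∷ T) → Spans S′ T) → (∀ T → Spans S′ T → Spans S (e ∷ T)) →
  forests (suc k) S (e ∷ es) ≡ forests k S′ es ℕ.+ forests (suc k) S es
forests-suc k S S′ e es f g = cong (ℕ._+ forests (suc k) S es)
  (countSub-≗ es λ T → cong₂ _∧_ (sizeIs-suc k e T) (spansB-ext S S′ (e ∷ T) T (f T) (g T)))

-- `few` is carried through the induction to discard choices that waste an edge between two root
-- vertices. `pos` later makes τ(G) invertible.
record MatrixTree (S : Subset n) (es : Edges n) : Set where
  field
    few  : ∀ k → k ℕ.< ∣ S ∣ → forests k S es ≡ 0
    tree : + forests (∣ S ∣) S es ≡ det (laplacian es) S
    pos  : Spans S es → 0 ℕ.< forests (∣ S ∣) S es
open MatrixTree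

MatrixTree-↭ : {S : Subset n} {es es′ : Edges n} → es ↭ es′ → MatrixTree S es′ → MatrixTree S es
MatrixTree-↭ {S = S} {es} {es′} r m = record
  { few  = λ k lt → trans (forests-↭ k S r) (few m k lt)
  ; tree = trans (cong +_ (forests-↭ (∣ S ∣) S r))
      (trans (tree m) (det-cong S λ i j _ _ → sym (laplacian-↭ r i j)))
  ; pos  = λ h → subst (0 ℕ.<_) (sym (forests-↭ (∣ S ∣) S r)) (pos m λ v → Reach-mono base (∈-resp-↭ r) (h v))
  }

span-loop : (S : Subset n) {a b : Fin n} → S ∌ a → S ∌ b → ∀ T → Spans S ((a , b) ∷ T) → Spans S T
span-loop S pa pb T h v = Reach-map base
  (λ { (here refl) → (λ _ → root S pb) , (λ _ → root S pa)
     ; (there m) → (λ r → fwd r m) , (λ r → bwd r m) }) (h v)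

-- Choosing the edge leaves fewer than `∣ S ∣` edges to reach all of S, which `few` excludes; the
-- Laplacian changes only in entries outside S.
matrixTree-loop : {S : Subset n} {a b : Fin n} {es : Edges n} → S ∌ a → S ∌ b → MatrixTree S es → MatrixTree S ((a , b) ∷ es)
matrixTree-loop {S = S} {a} {b} {es} pa pb m = record
  { few  = λ k lt → trans (drop k (ℕₚ.<⇒≤ lt)) (few m k lt)
  ; tree = trans (cong +_ (drop ∣ S ∣ ℕₚ.≤-refl)) (trans (tree m) (det-cong S agree))
  ; pos  = λ h → subst (0 ℕ.<_) (sym (drop ∣ S ∣ ℕₚ.≤-refl)) (pos m (span-loop S pa pb es h))
  }
  where
  drop : ∀ k → k ℕ.≤ ∣ S ∣ → forests k S ((a , b) ∷ es) ≡ forests k S es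
  drop zero lt = forests-0 S (a , b) es
  drop (suc k) lt = trans
    (forests-suc k S S (a , b) es (span-loop S pa pb) (λ T h v → Reach-mono base there (h v)))
    (cong (ℕ._+ forests (suc k) S es) (few m k lt))
  agree : AgreeOn S (laplacian es) (laplacian ((a , b) ∷ es))
  agree i j pi pj = sym (trans
    (cong₂ (λ x y → (x - y) * (δ a j - δ b j) + laplacian es i j) (δ-∌ S pa pi) (δ-∌ S pb pi))
    (ℤₚ.+-identityˡ (laplacian es i j)))

Joins : Fin n × Fin n → Fin n → Fin n → Set
Joins e a b = e ≡ (a , b) ⊎ e ≡ (b , a)

contract-spans : (S : Subset n) {a b : Fin n} {e : Fin n × Fin n} → S ∌ b → Joins e a b → ∀ T → Spans S (e ∷ T) → Spans (S ∖ a) T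
contract-spans S {a} {b} {e} pb j T h v = Reach-map
  (λ p → root (S ∖ a) (∌-∖ S a (unroot S p)))
  (λ { (here refl) → ends j ; (there m) → (λ r → fwd r m) , (λ r → bwd r m) }) (h v)
  where
  B : VSet _
  B = not ∘ lookup (S ∖ a)
  a-root : Reach B T a
  a-root = root (S ∖ a) (∖-self S a)
  b-root : Reach B T b
  b-root = root (S ∖ a) (∌-∖ S a pb)
  ends : ∀ {u w} → Joins (u , w) a b → (Reach B T u → Reach B T w) × (Reach B T w → Reach B T u)
  ends (inj₁ refl) = (λ _ → b-root) , (λ _ → a-root)
  ends (inj₂ refl) = (λ _ → a-root) , (λ _ → b-root)

spans-contract : (S : Subset n) {a b : Fin n} {e : Fin n × Fin n} → S ∌ b → Joins e a b → ∀ T → Spans (S ∖ a) T → Spans S (e ∷ T)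
spans-contract S {a} {b} {e} pb j T h v = Reach-mono start there (h v)
  where
  join : Joins e a b → Reach (not ∘ lookup S) (e ∷ T) a
  join (inj₁ refl) = bwd (root S pb) (here refl)
  join (inj₂ refl) = fwd (root S pb) (here refl)
  start : ∀ {v} → not (lookup (S ∖ a) v) ≡ true → Reach (not ∘ lookup S) (e ∷ T) v
  start {v} p with v ≟ a
  ... | yes refl = join j
  ... | no v≢a = root S (trans (sym (∖-other S v≢a)) (unroot (S ∖ a) p))

-- Contraction moves a into the root, which lowers `∣ S ∣` and the number of edges still to be
-- chosen together. The determinants obey the same recursion by `det-diagonal-step`.
matrixTree-contract : {S : Subset n} {a b : Fin n} {e : Fin n × Fin n} {es : Edges n} → S ∋ a → S ∌ b → Joins e a b →
  MatrixTree S es → MatrixTree (S ∖ a) es → MatrixTree S (e ∷ es)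
matrixTree-contract {S = S} {a} {b} {e} {es} pa pb j m m′ = record
  { few  = few′
  ; tree = trans (cong +_ split) (trans (cong₂ _+_ (tree m′) (tree m))
             (sym (det-diagonal-step (laplacian-sym es) (laplacian-sym (e ∷ es)) S a pa (agree j))))
  ; pos  = λ h → subst (0 ℕ.<_) (sym split)
             (ℕₚ.<-≤-trans (pos m′ (contract-spans S pb j es h)) (ℕₚ.m≤m+n _ _))
  }
  where
  delete-contract : ∀ k → forests (suc k) S (e ∷ es) ≡ forests k (S ∖ a) es ℕ.+ forests (suc k) S es
  delete-contract k = forests-suc k S (S ∖ a) e es (contract-spans S pb j) (spans-contract S pb j)
  few′ : ∀ k → k ℕ.< ∣ S ∣ → forests k S (e ∷ es) ≡ 0
  few′ zero lt = trans (forests-0 S e es) (few m 0 lt)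
  few′ (suc k) lt = trans (delete-contract k)
    (cong₂ ℕ._+_ (few m′ k (ℕ.s≤s⁻¹ (subst (suc k ℕ.<_) (∣∖∣ S a pa) lt))) (few m (suc k) lt))
  split : forests (∣ S ∣) S (e ∷ es) ≡ forests (∣ S ∖ a ∣) (S ∖ a) es ℕ.+ forests (∣ S ∣) S es
  split = subst (λ k → forests k S (e ∷ es) ≡ forests (∣ S ∖ a ∣) (S ∖ a) es ℕ.+ forests k S es)
    (sym (∣∖∣ S a pa)) (delete-contract (∣ S ∖ a ∣))
  agree : Joins e a b → AgreeOn S (laplacian (e ∷ es)) (λ i j → laplacian es i j + δ i a * δ j a)
  agree (inj₁ refl) i j pi pj = trans
    (cong₂ (λ x y → (δ a i - x) * (δ a j - y) + laplacian es i j) (δ-∌ S pb pi) (δ-∌ S pb pj))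
    (trans (cong₂ (λ x y → (x - + 0) * (y - + 0) + laplacian es i j) (δ-sym a i) (δ-sym a j))
           (lem (δ i a) (δ j a) (laplacian es i j)))
    where
    lem : ∀ x y l → (x - + 0) * (y - + 0) + l ≡ l + x * y
    lem = solve-∀
  agree (inj₂ refl) i j pi pj = trans
    (cong₂ (λ x y → (x - δ a i) * (y - δ a j) + laplacian es i j) (δ-∌ S pb pi) (δ-∌ S pb pj))
    (trans (cong₂ (λ x y → (+ 0 - x) * (+ 0 - y) + laplacian es i j) (δ-sym a i) (δ-sym a j))
           (lem (δ i a) (δ j a) (laplacian es i j)))
    where
    lem : ∀ x y l → (+ 0 - x) * (+ 0 - y) + l ≡ l + x * y
    lem = solve-∀

Inside : VSet n → Fin n × Fin n → Set
Inside V (a , b) = V a ≡ true × V b ≡ true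

isolated : (S : Subset n) {T : Edges n} → All (Inside (lookup S)) T → ∀ {v} → Reach (not ∘ lookup S) T v → S ∌ v
isolated S ins (base p) = unroot S p
isolated S ins (fwd r m) = ∌-∋ S (isolated S ins r) (proj₁ (All.lookup ins m))
isolated S ins (bwd r m) = ∌-∋ S (isolated S ins r) (proj₂ (All.lookup ins m))

laplacian-colsum : (S : Subset n) {es : Edges n} → All (Inside (lookup S)) es → ∀ c →
  sum (λ v → ind (lookup S v) * laplacian es v c) ≡ + 0
laplacian-colsum S [] c = sum-zero λ v → ℤₚ.*-zeroʳ (ind (lookup S v))
laplacian-colsum S {(a , b) ∷ es} ((pa , pb) ∷ ins) c = begin
  sum (λ v → ind (lookup S v) * ((δ a v - δ b v) * X + laplacian es v c))
    ≡⟨ sum-cong-≗ (λ v → lem (ind (lookup S v)) (δ a v) (δ b v) X (laplacian es v c)) ⟩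
  sum (λ v → (δ a v * (ind (lookup S v) * X) - δ b v * (ind (lookup S v) * X)) + ind (lookup S v) * laplacian es v c)
    ≡⟨ ∑-distrib-+ (λ v → δ a v * (ind (lookup S v) * X) - δ b v * (ind (lookup S v) * X)) (λ v → ind (lookup S v) * laplacian es v c) ⟩
  sum (λ v → δ a v * (ind (lookup S v) * X) - δ b v * (ind (lookup S v) * X)) + sum (λ v → ind (lookup S v) * laplacian es v c)
    ≡⟨ cong₂ _+_ (sum-sub (λ v → δ a v * (ind (lookup S v) * X)) (λ v → δ b v * (ind (lookup S v) * X))) (laplacian-colsum S ins c) ⟩
  sum (λ v → δ a v * (ind (lookup S v) * X)) - sum (λ v → δ b v * (ind (lookup S v) * X)) + + 0
    ≡⟨ cong (_+ + 0) (cong₂ _-_ (sum-δˡ (λ v → ind (lookup S v) * X) a) (sum-δˡ (λ v → ind (lookup S v) * X) b)) ⟩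
  ind (lookup S a) * X - ind (lookup S b) * X + + 0
    ≡⟨ cong₂ (λ x y → ind x * X - ind y * X + + 0) pa pb ⟩
  + 1 * X - + 1 * X + + 0 ≡⟨ lem₂ X ⟩
  + 0 ∎
  where
  open ≡-Reasoning
  X = δ a c - δ b c
  lem : ∀ i p q x l → i * ((p - q) * x + l) ≡ p * (i * x) - q * (i * x) + i * l
  lem = solve-∀
  lem₂ : ∀ x → + 1 * x - + 1 * x + + 0 ≡ + 0
  lem₂ = solve-∀

matrixTree-isolated : {S : Subset n} {es : Edges n} → All (Inside (lookup S)) es → MatrixTree S es
matrixTree-isolated {S = S} {es} ins with first (lookup S) in e
... | just u = record
  { few  = λ k _ → none k
  ; tree = trans (cong +_ (none ∣ S ∣)) (sym (det-singular (laplacian-sym es) S u∈S λ c _ → laplacian-colsum S ins c))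
  ; pos  = λ h → ∌-∋ S (isolated S ins (h u)) u∈S
  }
  where
  u∈S : S ∋ u
  u∈S = first-just (lookup S) e
  none : ∀ k → forests k S es ≡ 0
  none k = trans
    (countSub-cong ins λ T insT → trans
      (cong (sizeIs k T ∧_) (spansB-false S T λ h → ∌-∋ S (isolated S insT (h u)) u∈S)) (Boolₚ.∧-zeroʳ (sizeIs k T)))
    (countSub-const-false es)
-- For empty S everything is root: the one sublist of size 0 spans, in accordance with the empty
-- determinant 1.
... | nothing = record
  { few  = λ k lt → case subst (k ℕ.<_) empty lt of λ ()
  ; tree = trans (cong +_ one) (sym (det-empty (laplacian es) S empty))
  ; pos  = λ _ → subst (0 ℕ.<_) (sym one) (ℕ.s≤s ℕ.z≤n)
  }
  where
  empty : ∣ S ∣ ≡ 0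
  empty = empty-∣∣ S (first-nothing (lookup S) e)
  one₀ : ∀ es → forests 0 S es ≡ 1
  one₀ [] = cong (λ b → if b then 1 else 0) (spansB-complete S [] λ v → root S (first-nothing (lookup S) e v))
  one₀ (f ∷ es) = trans (forests-0 S f es) (one₀ es)
  one : forests (∣ S ∣) S es ≡ 1
  one = trans (cong (λ k → forests k S es) empty) (one₀ es)

findTouching : (S : Subset n) (es : Edges n) → All (Inside (lookup S)) es ⊎
  (∃ λ e → ∃ λ es′ → es ↭ e ∷ es′ × (S ∌ proj₁ e ⊎ S ∌ proj₂ e))
findTouching S [] = inj₁ []
findTouching S (e ∷ es) with ∋? S (proj₁ e) | ∋? S (proj₂ e) | findTouching S es
... | inj₂ p | _ | _ = inj₂ (e , es , refl , inj₁ p)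
... | inj₁ _ | inj₂ p | _ = inj₂ (e , es , refl , inj₂ p)
... | inj₁ p | inj₁ q | inj₁ ins = inj₁ ((p , q) ∷ ins)
... | inj₁ _ | inj₁ _ | inj₂ (f , es′ , r , t) = inj₂ (f , e ∷ es′ , ↭-trans (prep e r) (swap e f refl) , t)

-- Deletion–contraction along an edge at the root; if there is none, both sides are trivial.
matrixTree-size : (k : ℕ) (es : Edges n) → length es ≡ k → (S : Subset n) → MatrixTree S es
matrixTree-size k es len S with findTouching S es
... | inj₁ ins = matrixTree-isolated ins
matrixTree-size zero [] len S | inj₂ (e , es′ , r , t) = case ↭-length r of λ ()
matrixTree-size (suc k) es len S | inj₂ ((a , b) , es′ , r , t) = MatrixTree-↭ r (go (∋? S a) (∋? S b) t)
  where
  ih : ∀ S′ → MatrixTree S′ es′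
  ih = matrixTree-size k es′ (ℕₚ.suc-injective (trans (sym (↭-length r)) len))
  go : S ∋ a ⊎ S ∌ a → S ∋ b ⊎ S ∌ b → S ∌ a ⊎ S ∌ b → MatrixTree S ((a , b) ∷ es′)
  go (inj₁ pa) (inj₂ pb) _ = matrixTree-contract pa pb (inj₁ refl) (ih S) (ih (S ∖ a))
  go (inj₂ pa) (inj₁ pb) _ = matrixTree-contract pb pa (inj₂ refl) (ih S) (ih (S ∖ b))
  go (inj₂ pa) (inj₂ pb) _ = matrixTree-loop pa pb (ih S)
  go (inj₁ pa) (inj₁ pb) (inj₁ qa) = ∌-∋ S qa pa
  go (inj₁ pa) (inj₁ pb) (inj₂ qb) = ∌-∋ S qb pb

matrixTree : (es : Edges n) (S : Subset n) → MatrixTree S es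
matrixTree es = matrixTree-size (length es) es refl

-- Spanning trees of a multigraph as rooted forests

single : Fin n → VSet n
single r v = v == r

Reach-trans : {T : Edges n} {r s v : Fin n} → Reach (single r) T s → Reach (single s) T v → Reach (single r) T v
Reach-trans {T = T} {r} p = Reach-mono (λ e → subst (Reach (single r) T) (sym (==-sound e)) p) (λ m → m)

start : {T : Edges n} (r : Fin n) → Reach (single r) T r
start r = base (==-refl r)

Reach-reverse : {T : Edges n} {r v : Fin n} → Reach (single r) T v → Reach (single v) T r
Reach-reverse {T = T} {r} {v} (base e) = subst (λ v → Reach (single v) T r) (sym (==-sound e)) (start r)
Reach-reverse (fwd p m) = Reach-trans (bwd (start _) m) (Reach-reverse p)
Reach-reverse (bwd p m) = Reach-trans (fwd (start _) m) (Reach-reverse p)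

rooted-∌ : {V : VSet n} {y v : Fin n} → V v ≡ true → tabulate V ∖ y ∌ v → v ≡ y
rooted-∌ {V = V} {y} {v} Vv p with v ≟ y
... | yes v≡y = v≡y
... | no v≢y = case trans (sym p) (trans (∖-other (tabulate V) v≢y) (trans (Vecₚ.lookup∘tabulate V v) Vv)) of λ ()

-- Besides y, the root set contains everything outside V. Edges inside V never leave V, so a walk
-- ending in V must have started at y.
Reach-root : {V : VSet n} {y : Fin n} {T : Edges n} → All (Inside V) T → ∀ {v} → V v ≡ true →
  Reach (not ∘ lookup (tabulate V ∖ y)) T v → Reach (single y) T v
Reach-root {V = V} {y} {T} ins Vv (base p) =
  subst (Reach (single y) T) (sym (rooted-∌ {V = V} Vv (unroot (tabulate V ∖ y) p))) (start y)
Reach-root ins Vv (fwd r m) = fwd (Reach-root ins (proj₁ (All.lookup ins m)) r) m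
Reach-root ins Vv (bwd r m) = bwd (Reach-root ins (proj₂ (All.lookup ins m)) r) m

-- `connectedB` explores from the least vertex of V, `spansB` from y and the outside of V.
-- Reachability is undirected, so the starting point can be moved within V.
connectedB-spansB : (V : VSet n) {y : Fin n} → V y ≡ true → {T : Edges n} → All (Inside V) T →
  connectedB V T ≡ spansB (tabulate V ∖ y) T
connectedB-spansB {n} V {y} Vy {T} ins with first V in e
... | nothing = case trans (sym Vy) (first-nothing V e y) of λ ()
... | just r = bool-ext
    (λ c → spansB-complete S T (to (allB-sound _ c)))
    (λ s → allB-complete (λ v → not (V v) ∨ iter n (grow T) (single r) v) (from (spansB-sound S T s)))
  where
  S : Subset n
  S = tabulate V ∖ y
  reach : (∀ v → not (V v) ∨ iter n (grow T) (single r) v ≡ true) → ∀ v → V v ≡ true → Reach (single r) T v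
  reach c v Vv with ∨-true {not (V v)} (c v)
  ... | inj₁ p = case trans (sym p) (cong not Vv) of λ ()
  ... | inj₂ p = reach-sound T (single r) n p
  to : (∀ v → not (V v) ∨ iter n (grow T) (single r) v ≡ true) → Spans S T
  to c v with ∋? S v
  ... | inj₂ p = root S p
  ... | inj₁ p = Reach-mono (λ e′ → root S (subst (S ∌_) (sym (==-sound e′)) (∖-self (tabulate V) y))) (λ m → m)
    (Reach-trans (Reach-reverse (reach c y Vy))
      (reach c v (trans (sym (Vecₚ.lookup∘tabulate V v)) (proj₂ (∖-∋ (tabulate V) p)))))
  from : Spans S T → ∀ v → not (V v) ∨ iter n (grow T) (single r) v ≡ true
  from s v with V v in Vv
  ... | false = refl
  ... | true = reach-complete T (single r) (Reach-trans
    (Reach-reverse (Reach-root ins (first-just V e) (s r))) (Reach-root ins Vv (s v)))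

private
  length-filter-map-suc : (p : Fin (suc n) → Bool) (vs : List (Fin n)) →
    length (filter (λ i → p i Data.Bool.≟ true) (map suc vs)) ≡ length (filter (λ i → p (suc i) Data.Bool.≟ true) vs)
  length-filter-map-suc p [] = refl
  length-filter-map-suc p (v ∷ vs) with p (suc v)
  ... | true = cong suc (length-filter-map-suc p vs)
  ... | false = length-filter-map-suc p vs

countB-size : (p : Fin n → Bool) → countB p ≡ ∣ tabulate p ∣
countB-size {zero} p = refl
countB-size {suc n} p with p zero
... | true = cong suc (trans (length-filter-map-suc p (allFin n)) (countB-size (p ∘ suc)))
... | false = trans (length-filter-map-suc p (allFin n)) (countB-size (p ∘ suc))

τ-forests : (M : MGraph n) {y : Fin n} → verts M y ≡ true → All (Inside (verts M)) (edges M) →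
  τ M ≡ forests ∣ tabulate (verts M) ∖ y ∣ (tabulate (verts M) ∖ y) (edges M)
τ-forests M {y} Vy ins = trans
  (countSub-subsets (λ T → sizeIs (countB (verts M) ℕ.∸ 1) T ∧ connectedB (verts M) T) (edges M))
  (countSub-cong ins λ T insT → cong₂ (λ k b → sizeIs k T ∧ b) size (connectedB-spansB (verts M) Vy insT))
  where
  -- The truncated subtraction is exact because y is one of the vertices.
  size : countB (verts M) ℕ.∸ 1 ≡ ∣ tabulate (verts M) ∖ y ∣
  size = trans (cong (ℕ._∸ 1) (countB-size (verts M)))
    (cong (ℕ._∸ 1) (∣∖∣ (tabulate (verts M)) y (trans (Vecₚ.lookup∘tabulate (verts M) y) Vy)))

-- Laplacians of graphs and of contracted graphs

sumℤ-map-suc : (f : Fin (suc n) → ℤ) (vs : List (Fin n)) → sumℤ (map f (map suc vs)) ≡ sumℤ (map (f ∘ suc) vs)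
sumℤ-map-suc f vs = cong sumℤ (sym (Listₚ.map-∘ vs))

sumℤ-allFin : (f : Fin n → ℤ) → sumℤ (map f (allFin n)) ≡ sum f
sumℤ-allFin {zero} f = refl
sumℤ-allFin {suc n} f = cong (_+_ (f zero)) (trans (sumℤ-map-suc f (allFin n)) (sumℤ-allFin (f ∘ suc)))

sumℤ-++ : (xs ys : List ℤ) → sumℤ (xs ++ ys) ≡ sumℤ xs + sumℤ ys
sumℤ-++ [] ys = sym (ℤₚ.+-identityˡ _)
sumℤ-++ (x ∷ xs) ys = trans (cong (_+_ x) (sumℤ-++ xs ys)) (sym (ℤₚ.+-assoc x _ _))

sumℤ-concatMap : (g : A′ → ℤ) (f : A → List A′) (xs : List A) →
  sumℤ (map g (concatMap f xs)) ≡ sumℤ (map (λ x → sumℤ (map g (f x))) xs)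
sumℤ-concatMap g f [] = refl
sumℤ-concatMap g f (x ∷ xs) = trans (cong sumℤ (Listₚ.map-++ g (f x) (concatMap f xs)))
  (trans (sumℤ-++ (map g (f x)) _) (cong (_+_ (sumℤ (map g (f x)))) (sumℤ-concatMap g f xs)))

sumℤ-zero : (g : A → ℤ) {xs : List A} → All (λ x → g x ≡ + 0) xs → sumℤ (map g xs) ≡ + 0
sumℤ-zero g [] = refl
sumℤ-zero g (e ∷ es) = cong₂ _+_ e (sumℤ-zero g es)

sumℤ-cong : {g h : A → ℤ} {xs : List A} → All (λ x → g x ≡ h x) xs → sumℤ (map g xs) ≡ sumℤ (map h xs)
sumℤ-cong [] = refl
sumℤ-cong (e ∷ es) = cong₂ _+_ e (sumℤ-cong es)

laplacian-sumℤ : (es : Edges n) → ∀ i j → laplacian es i j ≡ sumℤ (map (λ e → edgeForm e i j) es)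
laplacian-sumℤ [] i j = refl
laplacian-sumℤ (e ∷ es) i j = cong (_+_ (edgeForm e i j)) (laplacian-sumℤ es i j)

subset-ext : {S T : Subset n} → (∀ v → lookup S v ≡ lookup T v) → S ≡ T
subset-ext {S = S} {T} h = trans (sym (Vecₚ.tabulate∘lookup S)) (trans (Vecₚ.tabulate-cong h) (Vecₚ.tabulate∘lookup T))

weightedLaplacian : Graph n → (Fin n → ℤ) → Matrix n
weightedLaplacian G w i j = δ i j * w i - ind (adj G i j)

weightedLaplacian-sym : (G : Graph n) (w : Fin n → ℤ) → Symmetric (weightedLaplacian G w)
weightedLaplacian-sym G w i j = cong₂ _-_ diag (cong ind (Graph.sym G i j))
  where
  diag : δ i j * w i ≡ δ j i * w j
  diag with toSum (i ≟ j)
  ... | inj₁ refl = refl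
  ... | inj₂ i≢j = trans (cong (_* w i) (δ-≢ i≢j)) (sym (cong (_* w j) (δ-≢ (i≢j ∘ sym))))

size-sum : (p : Fin n → Bool) → + ∣ tabulate p ∣ ≡ sum (ind ∘ p)
size-sum {zero} p = refl
size-sum {suc n} p with p zero
... | true = cong (_+_ (+ 1)) (size-sum (p ∘ suc))
... | false = trans (size-sum (p ∘ suc)) (sym (ℤₚ.+-identityˡ _))

dG-sum : (G : Graph n) (a : Fin n) → dG G a ≡ sum (λ j → ind (adj G a j))
dG-sum G a = trans (cong +_ (countB-size (adj G a))) (size-sum (adj G a))

sum-pick₁ : (F : Fin n → Fin n → ℤ) (a : Fin n) → sum (λ i → sum (λ j → δ i a * F i j)) ≡ sum (F a)
sum-pick₁ F a = trans
  (sum-cong-≗ λ i → trans (sym (*-distribˡ-sum (δ i a) (F i))) (ℤₚ.*-comm (δ i a) (sum (F i))))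
  (sum-δʳ (λ i → sum (F i)) a)

sum-pick₂ : (F : Fin n → Fin n → ℤ) (a : Fin n) → sum (λ i → sum (λ j → δ j a * F i j)) ≡ sum (λ i → F i a)
sum-pick₂ F a = sum-cong-≗ λ i → trans
  (sum-cong-≗ λ j → cong (_* F i j) (δ-sym j a)) (sum-δˡ (F i) a)

ascending : Graph n → Fin n → Fin n → Bool
ascending G i j = ⌊ toℕ i ℕ.<? toℕ j ⌋ ∧ adj G i j

ascending-sum : (G : Graph n) (a j : Fin n) → ind (ascending G a j) + ind (ascending G j a) ≡ ind (adj G a j)
ascending-sum G a j with Finₚ.<-cmp a j | toℕ a ℕ.<? toℕ j | toℕ j ℕ.<? toℕ a
... | tri< a<j _ _ | no ≮ | _ = contradiction a<j ≮
... | tri< _ _ ≯ | yes _ | yes > = contradiction > ≯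
... | tri< _ _ _ | yes _ | no _ = ℤₚ.+-identityʳ _
... | tri> _ _ > | _ | no ≯ = contradiction > ≯
... | tri> ≮ _ _ | yes < | _ = contradiction < ≮
... | tri> _ _ _ | no _ | yes _ = trans (ℤₚ.+-identityˡ _) (cong ind (Graph.sym G j a))
... | tri≈ ≮ _ _ | yes < | _ = contradiction < ≮
... | tri≈ _ _ ≯ | no _ | yes > = contradiction > ≯
... | tri≈ _ refl _ | no _ | no _ = sym (cong ind (irrefl G a))

-- The product (δ i a - δ j a)(δ i b - δ j b) opens into four terms. Two live on the diagonal and
-- count the edges at a by their lower and by their upper end, together the degree; the two mixed
-- ones add up to the adjacency by `ascending-sum`.
laplacian-edgeList : (G : Graph n) → ∀ a b → laplacian (edgeList G) a b ≡ weightedLaplacian G (dG G) a b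
laplacian-edgeList {n} G a b = begin
  laplacian (edgeList G) a b ≡⟨ laplacian-sumℤ (edgeList G) a b ⟩
  sumℤ (map form (edgeList G))
    ≡⟨ trans (sumℤ-concatMap form _ (allFin n)) (sumℤ-allFin (λ i → sumℤ (map form (concatMap (cell i) (allFin n))))) ⟩
  sum (λ i → sumℤ (map form (concatMap (λ j → cell i j) (allFin n))))
    ≡⟨ sum-cong-≗ (λ i → trans (sumℤ-concatMap form (cell i) (allFin n)) (sumℤ-allFin (λ j → sumℤ (map form (cell i j))))) ⟩
  sum (λ i → sum (λ j → sumℤ (map form (cell i j))))
    ≡⟨ sum-cong-≗ (λ i → sum-cong-≗ λ j → trans (one i j) (lem (w i j) (δ i a) (δ j a) (δ i b) (δ j b))) ⟩
  sum (λ i → sum (λ j → δ i a * (δ i b * w i j) + δ j a * (δ j b * w i j) - (δ i a * (δ j b * w i j) + δ j a * (δ i b * w i j))))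
    ≡⟨ split ⟩
  sum (λ i → sum (λ j → δ i a * (δ i b * w i j))) + sum (λ i → sum (λ j → δ j a * (δ j b * w i j))) -
  (sum (λ i → sum (λ j → δ i a * (δ j b * w i j))) + sum (λ i → sum (λ j → δ j a * (δ i b * w i j))))
    ≡⟨ cong₂ _-_
         (cong₂ _+_ (trans (sum-pick₁ (λ i j → δ i b * w i j) a) (sym (*-distribˡ-sum (δ a b) (w a))))
                    (trans (sum-pick₂ (λ i j → δ j b * w i j) a) (sym (*-distribˡ-sum (δ a b) (λ i → w i a)))))
         (cong₂ _+_ (trans (sum-pick₁ (λ i j → δ j b * w i j) a) (trans (sum-cong-≗ λ j → cong (_* w a j) (δ-sym j b)) (sum-δˡ (w a) b)))
                    (trans (sum-pick₂ (λ i j → δ i b * w i j) a) (trans (sum-cong-≗ λ i → cong (_* w i a) (δ-sym i b)) (sum-δˡ (λ i → w i a) b)))) ⟩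
  δ a b * sum (w a) + δ a b * sum (λ i → w i a) - (w a b + w b a)
    ≡⟨ cong₂ _-_ (trans (sym (ℤₚ.*-distribˡ-+ (δ a b) (sum (w a)) (sum (λ i → w i a)))) (cong (δ a b *_) degree)) (ascending-sum G a b) ⟩
  weightedLaplacian G (dG G) a b ∎
  where
  open ≡-Reasoning
  form : Fin n × Fin n → ℤ
  form e = edgeForm e a b
  w : Fin n → Fin n → ℤ
  w i j = ind (ascending G i j)
  cell : Fin n → Fin n → Edges n
  cell i j = if ascending G i j then (i , j) ∷ [] else []
  one : ∀ i j → sumℤ (map form (cell i j)) ≡ w i j * form (i , j)
  one i j with ascending G i j
  ... | true = trans (ℤₚ.+-identityʳ (form (i , j))) (sym (ℤₚ.*-identityˡ (form (i , j))))
  ... | false = refl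
  lem : ∀ w x y x′ y′ → w * ((x - y) * (x′ - y′)) ≡ x * (x′ * w) + y * (y′ * w) - (x * (y′ * w) + y * (x′ * w))
  lem = solve-∀
  ∑∑ : (Fin n → Fin n → ℤ) → ℤ
  ∑∑ F = sum (λ i → sum (F i))
  ∑∑-+ : ∀ F H → ∑∑ (λ i j → F i j + H i j) ≡ ∑∑ F + ∑∑ H
  ∑∑-+ F H = trans (sum-cong-≗ λ i → ∑-distrib-+ (F i) (H i)) (∑-distrib-+ (sum ∘ F) (sum ∘ H))
  ∑∑-sub : ∀ F H → ∑∑ (λ i j → F i j - H i j) ≡ ∑∑ F - ∑∑ H
  ∑∑-sub F H = trans (sum-cong-≗ λ i → sum-sub (F i) (H i)) (sum-sub (sum ∘ F) (sum ∘ H))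
  split = trans
    (∑∑-sub (λ i j → δ i a * (δ i b * w i j) + δ j a * (δ j b * w i j)) (λ i j → δ i a * (δ j b * w i j) + δ j a * (δ i b * w i j)))
    (cong₂ _-_ (∑∑-+ (λ i j → δ i a * (δ i b * w i j)) (λ i j → δ j a * (δ j b * w i j)))
               (∑∑-+ (λ i j → δ i a * (δ j b * w i j)) (λ i j → δ j a * (δ i b * w i j))))
  degree : sum (w a) + sum (λ i → w i a) ≡ dG G a
  degree = trans (sym (∑-distrib-+ (w a) (λ i → w i a))) (trans (sum-cong-≗ (ascending-sum G a)) (sym (dG-sum G a)))

∈-allFin : (i : Fin n) → i ∈ allFin n
∈-allFin zero = here refl
∈-allFin (suc i) = there (∈-map⁺ suc (∈-allFin i))

∈-edgeList : (G : Graph n) {i j : Fin n} → toℕ i ℕ.< toℕ j → adj G i j ≡ true → (i , j) ∈ edgeList G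
∈-edgeList {n} G {i} {j} i<j e = ∈-concatMap⁺ _ (lose (∈-allFin i) (∈-concatMap⁺ _ (lose (∈-allFin j) cell)))
  where
  cell : (i , j) ∈ (if ascending G i j then (i , j) ∷ [] else [])
  cell with toℕ i ℕ.<? toℕ j | adj G i j
  cell | yes _ | true = here refl
  cell | no ≮ | _ = contradiction i<j ≮

Reach-adjacent : (G : Graph n) {B : VSet n} {u v : Fin n} → adj G u v ≡ true → Reach B (edgeList G) u → Reach B (edgeList G) v
Reach-adjacent G {u = u} {v} e r with Finₚ.<-cmp u v
... | tri< u<v _ _ = fwd r (∈-edgeList G u<v e)
... | tri> _ _ v<u = bwd r (∈-edgeList G v<u (trans (Graph.sym G v u) e))
... | tri≈ _ refl _ = r

Reach-walk : (G : Graph n) {B : VSet n} {u v : Fin n} → Walk G u v → Reach B (edgeList G) u → Reach B (edgeList G) v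
Reach-walk G here r = r
Reach-walk G (step e w) r = Reach-walk G w (Reach-adjacent G e r)

allBut : Fin n → Subset n
allBut y = tabulate full ∖ y

private
  asMG-forests : (G : Graph n) (y : Fin n) → τ (asMG G) ≡ forests (∣ allBut y ∣) (allBut y) (edgeList G)
  asMG-forests G y = τ-forests (asMG G) {y} refl (All.universal (λ _ → refl , refl) (edgeList G))

τ-det : (G : Graph n) (y : Fin n) → + τ (asMG G) ≡ det (weightedLaplacian G (dG G)) (allBut y)
τ-det G y = trans (cong +_ (asMG-forests G y)) (trans (tree (matrixTree (edgeList G) (allBut y)))
  (det-cong (allBut y) λ i j _ _ → laplacian-edgeList G i j))

-- Walks from y reach every vertex along the edge list, and `pos` turns this into a spanning tree.
τ-pos : (G : Graph n) → Connected G → Fin n → 0 ℕ.< τ (asMG G)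
τ-pos G con y = subst (0 ℕ.<_) (sym (asMG-forests G y)) (pos (matrixTree (edgeList G) (allBut y))
  λ v → Reach-walk G (con y v) (root (allBut y) (∖-self (tabulate full) y)))

-- The matrix-tree theorem makes every principal minor of the Laplacian a cardinality.
det-nonneg : (G : Graph n) (S : Subset n) → + 0 ℤ.≤ det (weightedLaplacian G (dG G)) S
det-nonneg G S = subst (+ 0 ℤ.≤_)
  (trans (tree (matrixTree (edgeList G) S)) (det-cong S λ i j _ _ → laplacian-edgeList G i j)) (ℤ.+≤+ ℕ.z≤n)

weightedLaplacian-off : (G : Graph n) (w : Fin n → ℤ) {v z : Fin n} → v ≢ z → weightedLaplacian G w v z ≡ - ind (adj G v z)
weightedLaplacian-off G w {v} {z} v≢z = trans
  (cong (λ d → d * w v - ind (adj G v z)) (δ-≢ v≢z)) (ℤₚ.+-identityˡ (- ind (adj G v z)))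

-- The entry -1 at a neighbour cancels the sign in the recursion, and the diagonal entry meets a
-- vertex that is already removed. What remains is the recursion of `pathsF`.
adj-neighbours : (G : Graph n) (w : Fin n → ℤ) (S : Subset n) {v u : Fin n} → S ∋ v → v ≢ u →
  adjM (weightedLaplacian G w) S v u ≡ sum (λ z → ind (adj G v z) * adjM (weightedLaplacian G w) (S ∖ v) z u)
adj-neighbours G w S {v} {u} p v≢u = trans (adj-step L S p v≢u)
  (trans (sym (sum-neg (λ z → L v z * adjM L (S ∖ v) z u))) (sum-cong-≗ term))
  where
  L = weightedLaplacian G w
  lem : ∀ a x → - (- a * x) ≡ a * x
  lem = solve-∀
  term : ∀ z → - (L v z * adjM L (S ∖ v) z u) ≡ ind (adj G v z) * adjM L (S ∖ v) z u
  term z with toSum (v ≟ z)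
  ... | inj₂ v≢z = trans (cong (λ l → - (l * adjM L (S ∖ v) z u)) (weightedLaplacian-off G w v≢z))
                         (lem (ind (adj G v z)) (adjM L (S ∖ v) z u))
  ... | inj₁ refl = trans (cong (λ x → - (L v v * x)) out) (trans (cong -_ (ℤₚ.*-zeroʳ (L v v)))
                      (sym (trans (cong (ind (adj G v v) *_) out) (ℤₚ.*-zeroʳ (ind (adj G v v))))))
    where
    out : adjM L (S ∖ v) v u ≡ + 0
    out = adj-out L (S ∖ v) u (∖-self S v)

sum-nonneg : {f : Fin n → ℤ} → (∀ i → + 0 ℤ.≤ f i) → + 0 ℤ.≤ sum f
sum-nonneg {zero} h = ℤₚ.≤-refl
sum-nonneg {suc n} h = ℤₚ.+-mono-≤ (h zero) (sum-nonneg (h ∘ suc))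

ind*-nonneg : (b : Bool) {x : ℤ} → + 0 ℤ.≤ x → + 0 ℤ.≤ ind b * x
ind*-nonneg true {x} h = subst (+ 0 ℤ.≤_) (sym (ℤₚ.*-identityˡ x)) h
ind*-nonneg false h = ℤₚ.≤-refl

adj-nonneg-size : (G : Graph n) (k : ℕ) (S : Subset n) → ∣ S ∣ ℕ.≤ k → ∀ v u → + 0 ℤ.≤ adjM (weightedLaplacian G (dG G)) S v u
adj-nonneg-size G k S le v u with ∋? S v | toSum (v ≟ u)
... | inj₂ p | _ = ℤₚ.≤-reflexive (sym (adj-out _ S u p))
... | inj₁ p | inj₁ refl = subst (+ 0 ℤ.≤_) (sym (adj-diag _ S p)) (det-nonneg G (S ∖ v))
adj-nonneg-size G zero S le v u | inj₁ p | inj₂ _ = ∌-∋ S (∣∣≤0 S le v) p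
adj-nonneg-size G (suc k) S le v u | inj₁ p | inj₂ v≢u = subst (+ 0 ℤ.≤_) (sym (adj-neighbours G (dG G) S p v≢u))
  (sum-nonneg λ z → ind*-nonneg (adj G v z) (adj-nonneg-size G k (S ∖ v) (∣∖∣-pred S v p le) z u))

adj-nonneg : (G : Graph n) (S : Subset n) → ∀ v u → + 0 ℤ.≤ adjM (weightedLaplacian G (dG G)) S v u
adj-nonneg G S = adj-nonneg-size G ∣ S ∣ S ℕₚ.≤-refl

-- Contraction of a set of vertices

elem-head : (y : Fin n) (P : List (Fin n)) → elem y (y ∷ P) ≡ true
elem-head y P = ∨-introˡ (elem y P) (==-refl y)

-- A named copy of the local map in `contractTo`, equal to it by definition.
merge : List (Fin n) → Fin n → Fin n → Fin n
merge C y v = if elem v C then y else v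

mergeEdge : List (Fin n) → Fin n → Fin n × Fin n → Edges n
mergeEdge C y e = if merge C y (proj₁ e) == merge C y (proj₂ e) then [] else (merge C y (proj₁ e) , merge C y (proj₂ e)) ∷ []

merge-vert : (C : List (Fin n)) (y v : Fin n) → not (elem (merge C y v) C) ∨ (merge C y v == y) ≡ true
merge-vert C y v with elem v C in e
... | true = ∨-introʳ (not (elem y C)) (==-refl y)
... | false = ∨-introˡ (v == y) (cong not e)

mergeEdges-inside : (C : List (Fin n)) (y : Fin n) (es : Edges n) →
  All (Inside (λ v → not (elem v C) ∨ (v == y))) (concatMap (mergeEdge C y) es)
mergeEdges-inside C y [] = []
mergeEdges-inside C y ((a , b) ∷ es) = Allₚ.++⁺ one (mergeEdges-inside C y es)
  where
  one : All (Inside (λ v → not (elem v C) ∨ (v == y))) (mergeEdge C y (a , b))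
  one with merge C y a == merge C y b
  ... | true = []
  ... | false = (merge-vert C y a , merge-vert C y b) ∷ []

elem-≢ : {C : List (Fin n)} {u v : Fin n} → elem u C ≡ true → elem v C ≡ false → u ≢ v
elem-≢ p q refl = case trans (sym q) p of λ ()

merge-δ : {C : List (Fin n)} {y : Fin n} → elem y C ≡ true → ∀ v {a} → elem a C ≡ false → δ (merge C y v) a ≡ δ v a
merge-δ {C = C} py v pa with elem v C in e
... | false = refl
... | true = trans (δ-≢ (elem-≢ {C = C} py pa)) (sym (δ-≢ (elem-≢ {C = C} e pa)))

-- Deleting loops is harmless: the ends of a deleted edge have the same image, so its form is zero.
mergeEdge-form : {C : List (Fin n)} {y : Fin n} → elem y C ≡ true → ∀ e {a b} → elem a C ≡ false → elem b C ≡ false →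
  laplacian (mergeEdge C y e) a b ≡ edgeForm e a b
mergeEdge-form {C = C} {y} py (i , j) {a} {b} pa pb = trans form
  (cong₂ _*_ (cong₂ _-_ (merge-δ {C = C} py i pa) (merge-δ {C = C} py j pa))
             (cong₂ _-_ (merge-δ {C = C} py i pb) (merge-δ {C = C} py j pb)))
  where
  form : laplacian (mergeEdge C y (i , j)) a b ≡ edgeForm (merge C y i , merge C y j) a b
  form with merge C y i == merge C y j in e
  ... | false = ℤₚ.+-identityʳ _
  ... | true = sym (trans
    (cong (λ u → (δ u a - δ (merge C y j) a) * (δ (merge C y i) b - δ (merge C y j) b)) (==-sound {i = merge C y i} e))
    (cong (_* (δ (merge C y i) b - δ (merge C y j) b)) (ℤₚ.+-inverseʳ (δ (merge C y j) a))))

laplacian-++ : (es fs : Edges n) → ∀ i j → laplacian (es ++ fs) i j ≡ laplacian es i j + laplacian fs i j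
laplacian-++ [] fs i j = sym (ℤₚ.+-identityˡ _)
laplacian-++ (e ∷ es) fs i j = trans (cong (_+_ (edgeForm e i j)) (laplacian-++ es fs i j))
  (sym (ℤₚ.+-assoc (edgeForm e i j) (laplacian es i j) (laplacian fs i j)))

laplacian-merge : {C : List (Fin n)} {y : Fin n} → elem y C ≡ true → (es : Edges n) → ∀ {a b} → elem a C ≡ false → elem b C ≡ false →
  laplacian (concatMap (mergeEdge C y) es) a b ≡ laplacian es a b
laplacian-merge py [] pa pb = refl
laplacian-merge {C = C} {y} py (e ∷ es) {a} {b} pa pb = trans (laplacian-++ (mergeEdge C y e) (concatMap (mergeEdge C y) es) a b)
  (cong₂ _+_ (mergeEdge-form {C = C} py e pa pb) (laplacian-merge {C = C} py es pa pb))

minusPy-subset : (P : List (Fin n)) (y : Fin n) →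
  tabulate (λ v → not (elem v (y ∷ P)) ∨ (v == y)) ∖ y ≡ tabulate (minusPy P y)
minusPy-subset P y = subset-ext eq
  where
  V = λ v → not (elem v (y ∷ P)) ∨ (v == y)
  eq : ∀ v → lookup (tabulate V ∖ y) v ≡ lookup (tabulate (minusPy P y)) v
  eq v with toSum (v ≟ y)
  ... | inj₁ refl = trans (∖-self (tabulate V) v)
    (sym (trans (Vecₚ.lookup∘tabulate (minusPy P v) v) (cong not (elem-head v P))))
  ... | inj₂ v≢y = trans (∖-other (tabulate V) v≢y) (trans (Vecₚ.lookup∘tabulate V v)
    (trans (trans (cong (not (elem v (y ∷ P)) ∨_) (==-≢ v≢y)) (Boolₚ.∨-identityʳ _))
      (sym (Vecₚ.lookup∘tabulate (minusPy P y) v))))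

-- Merging C = y ∷ P affects the Laplacian only in the rows and columns of C, and none of these
-- enters the minor on the complement of C.
τ-contract : (G : Graph n) (P : List (Fin n)) (y : Fin n) →
  + τ (contractTo G (y ∷ P) y) ≡ det (weightedLaplacian G (dG G)) (tabulate (minusPy P y))
τ-contract G P y = begin
  + τ M ≡⟨ cong +_ (τ-forests M {y} (∨-introʳ (not (elem y C)) (==-refl y)) (mergeEdges-inside C y (edgeList G))) ⟩
  + forests (∣ tabulate (verts M) ∖ y ∣) (tabulate (verts M) ∖ y) (edges M)
    ≡⟨ tree (matrixTree (edges M) (tabulate (verts M) ∖ y)) ⟩
  det (laplacian (edges M)) (tabulate (verts M) ∖ y)
    ≡⟨ cong (det (laplacian (edges M))) (minusPy-subset P y) ⟩
  det (laplacian (edges M)) S ≡⟨ det-cong S agree ⟩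
  det (weightedLaplacian G (dG G)) S ∎
  where
  open ≡-Reasoning
  C = y ∷ P
  M = contractTo G C y
  S = tabulate (minusPy P y)
  outside : ∀ v → S ∋ v → elem v C ≡ false
  outside v p = trans (sym (Boolₚ.not-involutive (elem v C))) (cong not (trans (sym (Vecₚ.lookup∘tabulate (minusPy P y) v)) p))
  agree : AgreeOn S (laplacian (edges M)) (weightedLaplacian G (dG G))
  agree i j pi pj = trans (laplacian-merge {C = C} (elem-head y P) (edgeList G) (outside i pi) (outside j pj)) (laplacian-edgeList G i j)

-- Path sums and the invariant R

∖-tabulate : (S : VSet n) (a : Fin n) → tabulate S ∖ a ≡ tabulate (removeL (a ∷ []) S)
∖-tabulate S a = subset-ext eq
  where
  eq : ∀ v → lookup (tabulate S ∖ a) v ≡ lookup (tabulate (removeL (a ∷ []) S)) v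
  eq v with toSum (v ≟ a)
  ... | inj₁ refl = trans (∖-self (tabulate S) v) (sym (trans (Vecₚ.lookup∘tabulate (removeL (v ∷ []) S) v)
    (trans (cong (λ b → S v ∧ not b) (elem-head v [])) (Boolₚ.∧-zeroʳ (S v)))))
  ... | inj₂ v≢a = trans (∖-other (tabulate S) v≢a) (trans (Vecₚ.lookup∘tabulate S v)
    (sym (trans (Vecₚ.lookup∘tabulate (removeL (a ∷ []) S) v)
      (trans (cong (λ b → S v ∧ not (b ∨ false)) (==-≢ v≢a)) (Boolₚ.∧-identityʳ (S v))))))

size-removeL : (S : VSet n) (a : Fin n) (Q : List (Fin n)) {k : ℕ} → S a ≡ true → ∣ tabulate S ∣ ℕ.≤ suc k →
  ∣ tabulate (removeL (a ∷ Q) S) ∣ ℕ.≤ k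
size-removeL S a Q Sa le = ℕₚ.≤-trans
  (⊆-size (tabulate (removeL (a ∷ Q) S)) (tabulate S ∖ a) sub)
  (∣∖∣-pred (tabulate S) a (trans (Vecₚ.lookup∘tabulate S a) Sa) le)
  where
  sub : ∀ v → tabulate (removeL (a ∷ Q) S) ∋ v → tabulate S ∖ a ∋ v
  sub v p with ∧-true {S v} (trans (sym (Vecₚ.lookup∘tabulate (removeL (a ∷ Q) S) v)) p)
  ... | Sv , q with toSum (v ≟ a)
  ...   | inj₁ refl = case trans (sym q) (cong not (elem-head v Q)) of λ ()
  ...   | inj₂ v≢a = trans (∖-other (tabulate S) v≢a) (trans (Vecₚ.lookup∘tabulate S v) Sv)

-- Deleting a listed path therefore deletes at least its start, a member of S; this pays for the
-- unit of fuel that `RF` spends.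
paths-head : (G : Graph n) (f : ℕ) (S : VSet n) (a b : Fin n) → All (λ Q → S a ≡ true × ∃ λ Q′ → Q ≡ a ∷ Q′) (pathsF G f S a b)
paths-head G f S a b with S a | a == b
paths-head G f       S a b | false | _     = []
paths-head G f       S a b | true  | true  = (refl , [] , refl) ∷ []
paths-head G zero    S a b | true  | false = []
paths-head {n} G (suc f) S a b | true  | false = Allₚ.concat⁺ (Allₚ.map⁺ (All.universal one (allFin n)))
  where
  one : ∀ v → All (λ Q → true ≡ true × ∃ λ Q′ → Q ≡ a ∷ Q′) (if adj G a v then map (a ∷_) (pathsF G f (removeL (a ∷ []) S) v b) else [])
  one v with adj G a v
  ... | true = Allₚ.map⁺ (All.universal (λ Q → refl , Q , refl) _)
  ... | false = []

-- blocked P tests whether P leaves M, so that only the paths inside M contribute to the sum.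
module _ (G : Graph n) (w : Fin n → ℤ) (M : VSet n) (blocked : List (Fin n) → Bool)
  (blocked-[] : blocked [] ≡ false) (blocked-∷ : ∀ a P → blocked (a ∷ P) ≡ not (M a) ∨ blocked P) where

  private
    L : Matrix n
    L = weightedLaplacian G w

    within : VSet n → Subset n
    within S = tabulate (λ v → M v ∧ S v)

    value : VSet n → List (Fin n) → ℤ
    value S P = if blocked P then + 0 else det L (within (removeL P S))

    within-lookup : ∀ S v → lookup (within S) v ≡ M v ∧ S v
    within-lookup S v = Vecₚ.lookup∘tabulate (λ v → M v ∧ S v) v

    within-∖ : ∀ S a → within S ∖ a ≡ within (removeL (a ∷ []) S)
    within-∖ S a = trans (∖-tabulate (λ v → M v ∧ S v) a) (Vecₚ.tabulate-cong λ v → Boolₚ.∧-assoc (M v) (S v) _)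

    within-∷ : ∀ S a P → within (removeL (a ∷ P) S) ≡ within (removeL P (removeL (a ∷ []) S))
    within-∷ S a P = Vecₚ.tabulate-cong λ v → cong (M v ∧_) (lem (S v) (v == a) (elem v P))
      where
      lem : ∀ s e p → s ∧ not (e ∨ p) ≡ (s ∧ not (e ∨ false)) ∧ not p
      lem false e p = refl
      lem true false p = refl
      lem true true p = refl

    value-blocked : ∀ S a P → M a ≡ false → value S (a ∷ P) ≡ + 0
    value-blocked S a P Ma rewrite blocked-∷ a P | Ma = refl

    value-∷ : ∀ S a P → M a ≡ true → value S (a ∷ P) ≡ value (removeL (a ∷ []) S) P
    value-∷ S a P Ma rewrite blocked-∷ a P | Ma | within-∷ S a P = refl

    value-single : ∀ S a → M a ≡ true → value S (a ∷ []) ≡ det L (within S ∖ a)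
    value-single S a Ma rewrite blocked-∷ a [] | Ma | blocked-[] | within-∖ S a = refl

  -- Both sides satisfy the recursion that removes the first vertex. The list runs over paths in all
  -- of S while the adjugate sees only M ∩ S, and a path leaving M has value 0. `R` uses it with M =
  -- `full`, `pathSum` with M the complement of y.
  paths-adj : ∀ f S a b → ∣ tabulate S ∣ ℕ.≤ f → sumℤ (map (value S) (pathsF G f S a b)) ≡ adjM L (within S) a b
  paths-adj f S a b le with M a in Ma
  ... | false = trans (sumℤ-zero (value S) (All.map (λ { (_ , Q , refl) → value-blocked S a Q Ma }) (paths-head G f S a b)))
    (sym (adj-out L (within S) b (trans (within-lookup S a) (cong (_∧ S a) Ma))))
  ... | true with S a in Sa | a == b in ab
  paths-adj f S a b le | true | false | _ =
    sym (adj-out L (within S) b (trans (within-lookup S a) (cong₂ _∧_ Ma Sa)))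
  paths-adj f S a b le | true | true | true with ==-sound {i = a} ab
  ... | refl = trans (ℤₚ.+-identityʳ _) (trans (value-single S a Ma)
    (sym (adj-diag L (within S) (trans (within-lookup S a) (cong₂ _∧_ Ma Sa)))))
  paths-adj zero S a b le | true | true | false =
    ∌-∋ (tabulate S) (∣∣≤0 (tabulate S) le a) (trans (Vecₚ.lookup∘tabulate S a) Sa)
  paths-adj (suc f) S a b le | true | true | false = begin
    sumℤ (map (value S) (concatMap next (allFin n)))
      ≡⟨ trans (sumℤ-concatMap (value S) next (allFin n)) (sumℤ-allFin (λ v → sumℤ (map (value S) (next v)))) ⟩
    sum (λ v → sumℤ (map (value S) (next v))) ≡⟨ sum-cong-≗ term ⟩
    sum (λ v → ind (adj G a v) * adjM L (within S ∖ a) v b)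
      ≡⟨ sym (adj-neighbours G w (within S) (trans (within-lookup S a) (cong₂ _∧_ Ma Sa)) a≢b) ⟩
    adjM L (within S) a b ∎
    where
    open ≡-Reasoning
    a≢b : a ≢ b
    a≢b refl = case trans (sym ab) (==-refl a) of λ ()
    S′ = removeL (a ∷ []) S
    next : Fin n → List (List (Fin n))
    next v = if adj G a v then map (a ∷_) (pathsF G f S′ v b) else []
    term : ∀ v → sumℤ (map (value S) (next v)) ≡ ind (adj G a v) * adjM L (within S ∖ a) v b
    term v with adj G a v
    ... | false = refl
    ... | true = begin
      sumℤ (map (value S) (map (a ∷_) (pathsF G f S′ v b)))
        ≡⟨ cong sumℤ (trans (sym (Listₚ.map-∘ (pathsF G f S′ v b))) (Listₚ.map-cong (λ P → value-∷ S a P Ma) (pathsF G f S′ v b))) ⟩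
      sumℤ (map (value S′) (pathsF G f S′ v b))
        ≡⟨ paths-adj f S′ v b (size-removeL S a [] Sa le) ⟩
      adjM L (within S′) v b ≡⟨ cong (λ T → adjM L T v b) (sym (within-∖ S a)) ⟩
      adjM L (within S ∖ a) v b ≡⟨ sym (ℤₚ.*-identityˡ _) ⟩
      + 1 * adjM L (within S ∖ a) v b ∎

-- The term w x · R(S - x) is the diagonal part of the row of x against adj, since adj x x = det(S -
-- x); each path sum to a neighbour z is adj x z. So the recursion of `RF` is the expansion of the
-- minor at x.
RF-det : (G : Graph n) (w : Fin n → ℤ) (f : ℕ) (S : VSet n) → ∣ tabulate S ∣ ℕ.≤ f →
  RF G w f S ≡ det (weightedLaplacian G w) (tabulate S)
RF-det G w zero S le = sym (det-empty _ (tabulate S) (ℕₚ.n≤0⇒n≡0 le))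
RF-det {n} G w (suc f) S le with first S in e
... | nothing = sym (det-empty _ (tabulate S) (empty-∣∣ (tabulate S) λ v → trans (Vecₚ.lookup∘tabulate S v) (first-nothing S e v)))
... | just x = begin
  w x * RF G w f (removeL (x ∷ []) S) - sumℤ (map inner (allFin n))
    ≡⟨ cong₂ (λ a b → w x * a - b)
        (trans (RF-det G w f (removeL (x ∷ []) S) (size-removeL S x [] Sx le))
          (trans (cong (det L) (sym (∖-tabulate S x))) (sym (adj-diag L T x∈T))))
        (trans (sumℤ-allFin inner) (sum-cong-≗ term)) ⟩
  w x * adjM L T x x - sum (λ z → ind (adj G x z) * adjM L T x z)
    ≡⟨ cong (_- sum (λ z → ind (adj G x z) * adjM L T x z)) (sym (sum-δˡ (λ z → w x * adjM L T x z) x)) ⟩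
  sum (λ z → δ x z * (w x * adjM L T x z)) - sum (λ z → ind (adj G x z) * adjM L T x z)
    ≡⟨ sym (sum-sub (λ z → δ x z * (w x * adjM L T x z)) (λ z → ind (adj G x z) * adjM L T x z)) ⟩
  sum (λ z → δ x z * (w x * adjM L T x z) - ind (adj G x z) * adjM L T x z)
    ≡⟨ sum-cong-≗ (λ z → lem (δ x z) (w x) (ind (adj G x z)) (adjM L T x z)) ⟩
  expand L T x ≡⟨ sym (det-expand (weightedLaplacian-sym G w) T x x∈T) ⟩
  det L T ∎
  where
  open ≡-Reasoning
  L = weightedLaplacian G w
  T = tabulate S
  Sx : S x ≡ true
  Sx = first-just S e
  x∈T : T ∋ x
  x∈T = trans (Vecₚ.lookup∘tabulate S x) Sx
  lem : ∀ d w a K → d * (w * K) - a * K ≡ (d * w - a) * K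
  lem = solve-∀
  inner : Fin n → ℤ
  inner z = if S z ∧ adj G x z then sumℤ (map (λ Q → RF G w f (removeL Q S)) (paths G S x z)) else + 0
  pathValues : ∀ z → sumℤ (map (λ Q → RF G w f (removeL Q S)) (paths G S x z)) ≡ adjM L T x z
  pathValues z = trans
    (sumℤ-cong (All.map (λ { (_ , Q , refl) → RF-det G w f (removeL (x ∷ Q) S) (size-removeL S x Q Sx le) }) (paths-head G n S x z)))
    (paths-adj G w full (λ _ → false) refl (λ _ _ → refl) n S x z (Subsetₚ.∣p∣≤n T))
  term : ∀ z → inner z ≡ ind (adj G x z) * adjM L T x z
  term z with S z in Sz | adj G x z
  ... | false | b = sym (trans (cong (ind b *_) (adj-zeroʳ L T x (trans (Vecₚ.lookup∘tabulate S z) Sz))) (ℤₚ.*-zeroʳ (ind b)))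
  ... | true | true = trans (pathValues z) (sym (ℤₚ.*-identityˡ _))
  ... | true | false = refl

R-det : (G : Graph n) (w : Fin n → ℤ) (S : VSet n) → R G w S ≡ det (weightedLaplacian G w) (tabulate S)
R-det {n} G w S = RF-det G w n S (Subsetₚ.∣p∣≤n (tabulate S))

pathSum-adj : (G : Graph n) (x y : Fin n) →
  pathSum G x y ≡ sum (λ u → dG G u * adjM (weightedLaplacian G (dG G)) (allBut y) x u)
pathSum-adj {n} G x y = trans (sumℤ-allFin (λ u → dG G u * sumℤ (map value (paths G full x u))))
  (sum-cong-≗ λ u → cong (dG G u *_) (begin
  sumℤ (map value (paths G full x u))
    ≡⟨ cong sumℤ (Listₚ.map-cong (λ P → cong (λ r → if elem y P then + 0 else r)
         (trans (R-det G (dG G) (minusPy P y)) (cong (det L) (Vecₚ.tabulate-cong λ v → not-∨ (v == y) (elem v P))))) (paths G full x u)) ⟩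
  sumℤ (map (λ P → if elem y P then + 0 else det L (tabulate λ v → not (v == y) ∧ not (elem v P))) (paths G full x u))
    ≡⟨ paths-adj G (dG G) (λ v → not (v == y)) (elem y) refl
         (λ a P → cong (_∨ elem y P) (trans (==-sym y a) (sym (Boolₚ.not-involutive (a == y)))))
         n full x u (Subsetₚ.∣p∣≤n (tabulate {n = n} full)) ⟩
  adjM L (tabulate λ v → not (v == y) ∧ true) x u
    ≡⟨ cong (λ T → adjM L T x u) (trans
         (Vecₚ.tabulate-cong λ v → trans (Boolₚ.∧-identityʳ (not (v == y))) (cong not (sym (Boolₚ.∨-identityʳ (v == y)))))
         (sym (∖-tabulate full y))) ⟩
  adjM L (allBut y) x u ∎))
  where
  open ≡-Reasoning
  L = weightedLaplacian G (dG G)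
  value : List (Fin n) → ℤ
  value P = if elem y P then + 0 else R G (dG G) (minusPy P y)
  not-∨ : ∀ a b → not (a ∨ b) ≡ not a ∧ not b
  not-∨ true b = refl
  not-∨ false b = refl
  ==-sym : ∀ (i j : Fin n) → (i == j) ≡ (j == i)
  ==-sym i j = bool-ext (λ e → trans (cong (_== i) (sym (==-sound {i = i} e))) (==-refl i))
                        (λ e → trans (cong (_== j) (sym (==-sound {i = j} e))) (==-refl j))

R-contract : (G : Graph n) (P : List (Fin n)) (y : Fin n) → R G (dG G) (minusPy P y) ≡ + τ (contractTo G (y ∷ P) y)
R-contract G P y = trans (R-det G (dG G) (minusPy P y)) (sym (τ-contract G P y))

-- Convergence of the tail sums

-- `toℚ z` and `recip (suc k)` are by definition images of unnormalised fractions, where arithmetic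
-- reduces to integer identities.
fromℚᵘ-+ : ∀ p r → fromℚᵘ p ℚ.+ fromℚᵘ r ≡ fromℚᵘ (p ℚᵘ.+ r)
fromℚᵘ-+ p r = ℚₚ.toℚᵘ-injective (ℚᵘₚ.≃-trans (ℚₚ.toℚᵘ-homo-+ (fromℚᵘ p) (fromℚᵘ r))
  (ℚᵘₚ.≃-trans (ℚᵘₚ.+-cong (ℚₚ.toℚᵘ-fromℚᵘ p) (ℚₚ.toℚᵘ-fromℚᵘ r)) (ℚᵘₚ.≃-sym (ℚₚ.toℚᵘ-fromℚᵘ (p ℚᵘ.+ r)))))

fromℚᵘ-* : ∀ p r → fromℚᵘ p ℚ.* fromℚᵘ r ≡ fromℚᵘ (p ℚᵘ.* r)
fromℚᵘ-* p r = ℚₚ.toℚᵘ-injective (ℚᵘₚ.≃-trans (ℚₚ.toℚᵘ-homo-* (fromℚᵘ p) (fromℚᵘ r))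
  (ℚᵘₚ.≃-trans (ℚᵘₚ.*-cong (ℚₚ.toℚᵘ-fromℚᵘ p) (ℚₚ.toℚᵘ-fromℚᵘ r)) (ℚᵘₚ.≃-sym (ℚₚ.toℚᵘ-fromℚᵘ (p ℚᵘ.* r)))))

toℚ-+ : ∀ a b → toℚ (a + b) ≡ toℚ a ℚ.+ toℚ b
toℚ-+ a b = sym (trans (fromℚᵘ-+ (mkℚᵘ a 0) (mkℚᵘ b 0)) (ℚₚ.fromℚᵘ-cong {mkℚᵘ a 0 ℚᵘ.+ mkℚᵘ b 0} {mkℚᵘ (a + b) 0} (*≡* (lem a b))))
  where
  lem : ∀ a b → (a * + 1 + b * + 1) * + 1 ≡ (a + b) * + 1
  lem = solve-∀

toℚ-* : ∀ a b → toℚ (a * b) ≡ toℚ a ℚ.* toℚ b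
toℚ-* a b = sym (fromℚᵘ-* (mkℚᵘ a 0) (mkℚᵘ b 0))

recip-inverse : ∀ {d} → 0 ℕ.< d → recip d ℚ.* ofℕ d ≡ 1ℚ
recip-inverse {suc k} _ = trans (fromℚᵘ-* (mkℚᵘ (+ 1) k) (mkℚᵘ (+ suc k) 0))
  (ℚₚ.fromℚᵘ-cong {mkℚᵘ (+ 1) k ℚᵘ.* mkℚᵘ (+ suc k) 0} {mkℚᵘ (+ 1) 0} (*≡* (cong (λ m → + suc m) (lem k))))
  where
  lem : ∀ k → (k ℕ.+ 0) ℕ.* 1 ≡ k ℕ.* 1 ℕ.+ 0
  lem k = trans (cong (ℕ._* 1) (ℕₚ.+-identityʳ k)) (sym (ℕₚ.+-identityʳ (k ℕ.* 1)))

ofℕ-nonneg : ∀ k → 0ℚ ℚ.≤ ofℕ k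
ofℕ-nonneg k = ℚₚ.nonNegative⁻¹ (ofℕ k) {{ℚₚ.normalize-nonNeg k 1}}

toℚ-nonneg : ∀ {z} → + 0 ℤ.≤ z → 0ℚ ℚ.≤ toℚ z
toℚ-nonneg {+ k} _ = ofℕ-nonneg k

p≤p+nonneg : ∀ p {r} → 0ℚ ℚ.≤ r → p ℚ.≤ p ℚ.+ r
p≤p+nonneg p {r} h = subst (ℚ._≤ p ℚ.+ r) (ℚₚ.+-identityʳ p) (ℚₚ.+-monoʳ-≤ p h)

toℚ-mono : ∀ {a b} → a ℤ.≤ b → toℚ a ℚ.≤ toℚ b
toℚ-mono {a} {b} a≤b = subst (toℚ a ℚ.≤_) (trans (sym (toℚ-+ a (b - a))) (cong toℚ (lem a b)))
  (p≤p+nonneg (toℚ a) (toℚ-nonneg (ℤₚ.i≤j⇒0≤j-i a≤b)))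
  where
  lem : ∀ a b → a + (b - a) ≡ b
  lem = solve-∀

recip-nonneg : ∀ d → 0ℚ ℚ.≤ recip d
recip-nonneg zero = ℚₚ.≤-refl
recip-nonneg (suc k) = ℚₚ.nonNegative⁻¹ (recip (suc k)) {{ℚₚ.normalize-nonNeg 1 (suc k)}}

*-monoˡ : ∀ {p r s} → 0ℚ ℚ.≤ s → p ℚ.≤ r → s ℚ.* p ℚ.≤ s ℚ.* r
*-monoˡ {s = s} h = ℚₚ.*-monoˡ-≤-nonNeg s {{ℚ.nonNegative h}}

*-nonneg : ∀ {p r} → 0ℚ ℚ.≤ p → 0ℚ ℚ.≤ r → 0ℚ ℚ.≤ p ℚ.* r
*-nonneg {p} {r} hp hr = subst (ℚ._≤ p ℚ.* r) (ℚₚ.*-zeroʳ p) (*-monoˡ hp hr)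

archimedean : (c : ℕ) (ε : ℚ) → 0ℚ ℚ.< ε → ∃ λ N → ofℕ c ℚ.< ofℕ N ℚ.* ε
-- For ε = (p + 1) / (d-1 + 1) the product N · ε is (c + 1)(p + 1), which exceeds c.
archimedean c ε@(ℚ.mkℚ (+ suc p) d-1 _) 0<ε = suc c ℕ.* suc d-1 , (begin-strict
  ofℕ c <⟨ subst (ℚ._< ofℕ c ℚ.+ ofℕ 1) (ℚₚ.+-identityʳ (ofℕ c)) (ℚₚ.+-monoʳ-< (ofℕ c) (ℚₚ.positive⁻¹ 1ℚ)) ⟩
  ofℕ c ℚ.+ ofℕ 1 ≡⟨ trans (sym (toℚ-+ (+ c) (+ 1))) (cong (λ m → ofℕ m) (ℕₚ.+-comm c 1)) ⟩
  ofℕ (suc c) ≡⟨ sym (ℚₚ.*-identityʳ (ofℕ (suc c))) ⟩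
  ofℕ (suc c) ℚ.* 1ℚ ≤⟨ *-monoˡ (ofℕ-nonneg (suc c)) (toℚ-mono {+ 1} {+ suc p} (ℤ.+≤+ (ℕ.s≤s ℕ.z≤n))) ⟩
  ofℕ (suc c) ℚ.* ofℕ (suc p) ≡⟨ cong (ofℕ (suc c) ℚ.*_) (sym cleared) ⟩
  ofℕ (suc c) ℚ.* (ofℕ (suc d-1) ℚ.* ε) ≡⟨ sym (ℚₚ.*-assoc (ofℕ (suc c)) (ofℕ (suc d-1)) ε) ⟩
  ofℕ (suc c) ℚ.* ofℕ (suc d-1) ℚ.* ε ≡⟨ cong (ℚ._* ε) (sym (toℚ-* (+ suc c) (+ suc d-1))) ⟩
  ofℕ (suc c ℕ.* suc d-1) ℚ.* ε ∎)
  where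
  open ℚₚ.≤-Reasoning
  lem : ∀ (d p : ℤ) → d * p * + 1 ≡ p * d
  lem = solve-∀
  cleared : ofℕ (suc d-1) ℚ.* ε ≡ ofℕ (suc p)
  cleared = trans (cong (ofℕ (suc d-1) ℚ.*_) (sym (ℚₚ.↥p/↧p≡p ε)))
    (trans (fromℚᵘ-* (mkℚᵘ (+ suc d-1) 0) (mkℚᵘ (+ suc p) d-1))
      (ℚₚ.fromℚᵘ-cong {mkℚᵘ (+ suc d-1) 0 ℚᵘ.* mkℚᵘ (+ suc p) d-1} {mkℚᵘ (+ suc p) 0}
        (*≡* (trans (lem (+ suc d-1) (+ suc p)) (cong (λ m → + suc p * + suc m) (sym (ℕₚ.+-identityʳ d-1)))))))
archimedean c (ℚ.mkℚ (+ 0) d-1 _) (ℚ.*<* (ℤ.+<+ ()))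
archimedean c (ℚ.mkℚ ℤ.-[1+ p ] d-1 _) (ℚ.*<* ())

-- The potential a pays τ per unit of the summand p, so it decreases and τ · s N ≤ a 0; as a ≤ K · p,
-- N · a N ≤ K · s N ≤ K · a 0.
potential-converges : (s p a : ℕ → ℚ) (τ r K : ℚ) (c : ℕ) →
  s 0 ≡ 0ℚ → (∀ t → s (suc t) ≡ s t ℚ.+ p t) → (∀ t → 0ℚ ℚ.≤ p t) → (∀ t → 0ℚ ℚ.≤ a t) →
  (∀ t → a t ≡ τ ℚ.* p t ℚ.+ a (suc t)) → (∀ t → a t ℚ.≤ K ℚ.* p t) →
  1ℚ ℚ.≤ τ → 0ℚ ℚ.≤ r → r ℚ.* τ ≡ 1ℚ → 0ℚ ℚ.≤ K → K ℚ.* a 0 ℚ.≤ ofℕ c →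
  ConvergesTo s (r ℚ.* a 0)
potential-converges s p a τ r K c s₀ s₊ p≥0 a≥0 pay dom 1≤τ r≥0 rτ≡1 K≥0 bound ε ε>0 = N , close
  where
  open +-*-Solver using (solve; _:+_; _:*_; _:-_; :-_; _:=_)
  N : ℕ
  N = proj₁ (archimedean c ε ε>0)
  ≤τ* : ∀ {x} → 0ℚ ℚ.≤ x → x ℚ.≤ τ ℚ.* x
  ≤τ* {x} x≥0 = subst (ℚ._≤ τ ℚ.* x) (ℚₚ.*-identityˡ x) (ℚₚ.*-monoʳ-≤-nonNeg x {{ℚ.nonNegative x≥0}} 1≤τ)
  s≥0 : ∀ t → 0ℚ ℚ.≤ s t
  s≥0 zero = ℚₚ.≤-reflexive (sym s₀)
  s≥0 (suc t) = subst (0ℚ ℚ.≤_) (sym (s₊ t)) (ℚₚ.+-mono-≤ (s≥0 t) (p≥0 t))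
  antitone : ∀ t → a (suc t) ℚ.≤ a t
  antitone t = subst (a (suc t) ℚ.≤_) (trans (ℚₚ.+-comm (a (suc t)) _) (sym (pay t)))
    (p≤p+nonneg (a (suc t)) (ℚₚ.≤-trans (p≥0 t) (≤τ* (p≥0 t))))
  conserve : ∀ t → a 0 ≡ τ ℚ.* s t ℚ.+ a t
  conserve zero = sym (trans (cong (λ x → τ ℚ.* x ℚ.+ a 0) s₀) (trans (cong (ℚ._+ a 0) (ℚₚ.*-zeroʳ τ)) (ℚₚ.+-identityˡ (a 0))))
  conserve (suc t) = trans (conserve t) (trans (cong (τ ℚ.* s t ℚ.+_) (pay t))
    (trans (solve 4 (λ τ s p a → τ :* s :+ (τ :* p :+ a) := τ :* (s :+ p) :+ a) refl τ (s t) (p t) (a (suc t)))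
           (cong (λ x → τ ℚ.* x ℚ.+ a (suc t)) (sym (s₊ t)))))
  average : ∀ t → ofℕ t ℚ.* a t ℚ.≤ K ℚ.* s t
  average zero = ℚₚ.≤-trans (ℚₚ.≤-reflexive (ℚₚ.*-zeroˡ (a 0))) (*-nonneg K≥0 (s≥0 0))
  average (suc t) = begin
    ofℕ (suc t) ℚ.* a (suc t) ≤⟨ *-monoˡ (ofℕ-nonneg (suc t)) (antitone t) ⟩
    ofℕ (suc t) ℚ.* a t ≡⟨ cong (ℚ._* a t) (toℚ-+ (+ 1) (+ t)) ⟩
    (1ℚ ℚ.+ ofℕ t) ℚ.* a t ≡⟨ trans (ℚₚ.*-distribʳ-+ (a t) 1ℚ (ofℕ t)) (trans (cong (ℚ._+ ofℕ t ℚ.* a t) (ℚₚ.*-identityˡ (a t))) (ℚₚ.+-comm (a t) _)) ⟩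
    ofℕ t ℚ.* a t ℚ.+ a t ≤⟨ ℚₚ.+-mono-≤ (average t) (dom t) ⟩
    K ℚ.* s t ℚ.+ K ℚ.* p t ≡⟨ trans (sym (ℚₚ.*-distribˡ-+ K (s t) (p t))) (cong (K ℚ.*_) (sym (s₊ t))) ⟩
    K ℚ.* s (suc t) ∎
    where open ℚₚ.≤-Reasoning
  s≤a₀ : ∀ t → s t ℚ.≤ a 0
  s≤a₀ t = ℚₚ.≤-trans (≤τ* (s≥0 t)) (subst (τ ℚ.* s t ℚ.≤_) (sym (conserve t)) (p≤p+nonneg (τ ℚ.* s t) (a≥0 t)))
  small : ∀ m → N ℕ.≤ m → a m ℚ.< ε
  small m N≤m with a m ℚₚ.<? ε
  ... | yes a<ε = a<ε
  ... | no a≮ε = contradiction (begin-strict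
    ofℕ c <⟨ proj₂ (archimedean c ε ε>0) ⟩
    ofℕ N ℚ.* ε ≤⟨ *-monoˡ (ofℕ-nonneg N) (ℚₚ.≮⇒≥ a≮ε) ⟩
    ofℕ N ℚ.* a m ≤⟨ ℚₚ.*-monoʳ-≤-nonNeg (a m) {{ℚ.nonNegative (a≥0 m)}} (toℚ-mono (ℤ.+≤+ N≤m)) ⟩
    ofℕ m ℚ.* a m ≤⟨ average m ⟩
    K ℚ.* s m ≤⟨ *-monoˡ K≥0 (s≤a₀ m) ⟩
    K ℚ.* a 0 ≤⟨ bound ⟩
    ofℕ c ∎) (ℚₚ.<-irrefl refl)
    where open ℚₚ.≤-Reasoning
  error : ∀ m → s m ℚ.- r ℚ.* a 0 ≡ ℚ.- (r ℚ.* a m)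
  error m = begin
    s m ℚ.- r ℚ.* a 0 ≡⟨ cong (λ x → s m ℚ.- r ℚ.* x) (conserve m) ⟩
    s m ℚ.- r ℚ.* (τ ℚ.* s m ℚ.+ a m)
      ≡⟨ solve 4 (λ s r τ a → s :- r :* (τ :* s :+ a) := s :- (r :* τ) :* s :- r :* a) refl (s m) r τ (a m) ⟩
    s m ℚ.- (r ℚ.* τ) ℚ.* s m ℚ.- r ℚ.* a m ≡⟨ cong (λ x → s m ℚ.- x ℚ.* s m ℚ.- r ℚ.* a m) rτ≡1 ⟩
    s m ℚ.- 1ℚ ℚ.* s m ℚ.- r ℚ.* a m ≡⟨ cong (λ x → s m ℚ.- x ℚ.- r ℚ.* a m) (ℚₚ.*-identityˡ (s m)) ⟩
    s m ℚ.- s m ℚ.- r ℚ.* a m ≡⟨ trans (cong (ℚ._- r ℚ.* a m) (ℚₚ.+-inverseʳ (s m))) (ℚₚ.+-identityˡ _) ⟩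
    ℚ.- (r ℚ.* a m) ∎
    where open ≡-Reasoning
  close : ∀ m → N ℕ.≤ m → ℚ.∣ s m ℚ.- r ℚ.* a 0 ∣ ℚ.< ε
  close m N≤m = begin-strict
    ℚ.∣ s m ℚ.- r ℚ.* a 0 ∣ ≡⟨ cong ℚ.∣_∣ (error m) ⟩
    ℚ.∣ ℚ.- (r ℚ.* a m) ∣ ≡⟨ trans (ℚₚ.∣-p∣≡∣p∣ (r ℚ.* a m)) (ℚₚ.0≤p⇒∣p∣≡p (*-nonneg r≥0 (a≥0 m))) ⟩
    -- As 1 ≤ τ and r · τ = 1, the factor r does not enlarge the error, so a bound on a m is enough.
    r ℚ.* a m ≤⟨ ≤τ* (*-nonneg r≥0 (a≥0 m)) ⟩
    τ ℚ.* (r ℚ.* a m) ≡⟨ trans (sym (ℚₚ.*-assoc τ r (a m))) (cong (ℚ._* a m) (trans (ℚₚ.*-comm τ r) rτ≡1)) ⟩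
    1ℚ ℚ.* a m ≡⟨ ℚₚ.*-identityˡ (a m) ⟩
    a m <⟨ small m N≤m ⟩
    ε ∎
    where open ℚₚ.≤-Reasoning

sumℚ-allFin : (f : Fin n → ℚ) → sumℚ (map f (allFin n)) ≡ ∑ℚ.sum f
sumℚ-allFin {zero} f = refl
sumℚ-allFin {suc n} f = cong (f zero ℚ.+_)
  (trans (cong sumℚ (sym (Listₚ.map-∘ (allFin n)))) (sumℚ-allFin (f ∘ suc)))

sumℚ-zero : {f : Fin n → ℚ} → (∀ i → f i ≡ 0ℚ) → ∑ℚ.sum f ≡ 0ℚ
sumℚ-zero {zero} h = refl
sumℚ-zero {suc n} h = cong₂ ℚ._+_ (h zero) (sumℚ-zero (h ∘ suc))

sumℚ-single : (f : Fin n → ℚ) (u : Fin n) → (∀ i → i ≢ u → f i ≡ 0ℚ) → ∑ℚ.sum f ≡ f u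
sumℚ-single f zero h =
  trans (cong (f zero ℚ.+_) (sumℚ-zero λ i → h (suc i) λ ())) (ℚₚ.+-identityʳ _)
sumℚ-single f (suc u) h = trans (cong (ℚ._+ ∑ℚ.sum (f ∘ suc)) (h zero λ ()))
  (trans (ℚₚ.+-identityˡ _) (sumℚ-single (f ∘ suc) u λ i i≢u → h (suc i) (i≢u ∘ suc-injective)))

sumℚ-nonneg : {f : Fin n → ℚ} → (∀ i → 0ℚ ℚ.≤ f i) → 0ℚ ℚ.≤ ∑ℚ.sum f
sumℚ-nonneg {zero} h = ℚₚ.≤-refl
sumℚ-nonneg {suc n} h = ℚₚ.+-mono-≤ (h zero) (sumℚ-nonneg (h ∘ suc))

sumℚ-mono : {f g : Fin n → ℚ} → (∀ i → f i ℚ.≤ g i) → ∑ℚ.sum f ℚ.≤ ∑ℚ.sum g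
sumℚ-mono {zero} h = ℚₚ.≤-refl
sumℚ-mono {suc n} h = ℚₚ.+-mono-≤ (h zero) (sumℚ-mono (h ∘ suc))

toℚ-sum : (f : Fin n → ℤ) → toℚ (sum f) ≡ ∑ℚ.sum (toℚ ∘ f)
toℚ-sum {zero} f = refl
toℚ-sum {suc n} f = trans (toℚ-+ (f zero) (sum (f ∘ suc))) (cong (toℚ (f zero) ℚ.+_) (toℚ-sum (f ∘ suc)))

term≤sum : {f : Fin n → ℤ} → (∀ i → + 0 ℤ.≤ f i) → ∀ u → f u ℤ.≤ sum f
term≤sum {f = f} h zero = subst (ℤ._≤ f zero + sum (f ∘ suc)) (ℤₚ.+-identityʳ (f zero))
  (ℤₚ.+-monoʳ-≤ (f zero) (sum-nonneg (h ∘ suc)))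
term≤sum {f = f} h (suc u) = ℤₚ.≤-trans (term≤sum (h ∘ suc) u)
  (subst (ℤ._≤ f zero + sum (f ∘ suc)) (ℤₚ.+-identityˡ (sum (f ∘ suc))) (ℤₚ.+-monoˡ-≤ (sum (f ∘ suc)) (h zero)))

-- First-step equations and the hitting time

pathSum-target : (G : Graph n) (y : Fin n) → pathSum G y y ≡ + 0
pathSum-target G y = trans (pathSum-adj G y y) (sum-zero λ u → trans
  (cong (dG G u *_) (adj-out (weightedLaplacian G (dG G)) (allBut y) u (∖-self (tabulate full) y))) (ℤₚ.*-zeroʳ (dG G u)))

pathSum-nonneg : (G : Graph n) (x y : Fin n) → + 0 ℤ.≤ pathSum G x y
pathSum-nonneg G x y = subst (+ 0 ℤ.≤_) (sym (pathSum-adj G x y)) (sum-nonneg λ u →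
  subst (ℤ._≤ dG G u * adjM (weightedLaplacian G (dG G)) (allBut y) x u) (ℤₚ.*-zeroʳ (dG G u))
    (ℤₚ.*-monoˡ-≤-nonNeg (dG G u) (adj-nonneg G (allBut y) x u)))

-- The first-step equation of the hitting time, multiplied by τ(G) d_v: it is L · adj = det · I applied to the degrees.
pathSum-step : (G : Graph n) (y : Fin n) {v : Fin n} → v ≢ y →
  dG G v * pathSum G v y ≡ dG G v * + τ (asMG G) + sum (λ z → ind (adj G v z) * pathSum G z y)
pathSum-step G y {v} v≢y = begin
  dG G v * H v ≡⟨ lem (dG G v * H v) (sum (λ z → ind (adj G v z) * H z)) ⟩
  dG G v * H v - sum (λ z → ind (adj G v z) * H z) + sum (λ z → ind (adj G v z) * H z)
    ≡⟨ cong (_+ sum (λ z → ind (adj G v z) * H z)) (begin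
      dG G v * H v - sum (λ z → ind (adj G v z) * H z)
        ≡⟨ cong (_- sum (λ z → ind (adj G v z) * H z)) (sym (sum-δˡ (λ z → dG G v * H z) v)) ⟩
      sum (λ z → δ v z * (dG G v * H z)) - sum (λ z → ind (adj G v z) * H z)
        ≡⟨ sym (sum-sub (λ z → δ v z * (dG G v * H z)) (λ z → ind (adj G v z) * H z)) ⟩
      sum (λ z → δ v z * (dG G v * H z) - ind (adj G v z) * H z)
        ≡⟨ sum-cong-≗ (λ z → trans (lem₂ (δ v z) (dG G v) (ind (adj G v z)) (H z)) (cong (L v z *_)
             (trans (pathSum-adj G z y) (sum-cong-≗ λ u → ℤₚ.*-comm (dG G u) (K z u))))) ⟩
      sum (λ z → L v z * sum (λ u → K z u * dG G u)) ≡⟨ sym (sum-assoc (L v) K (dG G)) ⟩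
      sum (λ u → sum (λ z → L v z * K z u) * dG G u)
        ≡⟨ sum-cong-≗ (λ u → trans (cong (_* dG G u) (L·adj (weightedLaplacian-sym G (dG G)) (allBut y) v u v∈)) (lem₃ (δ v u) D (dG G u))) ⟩
      sum (λ u → δ v u * (dG G u * D)) ≡⟨ sum-δˡ (λ u → dG G u * D) v ⟩
      dG G v * D ≡⟨ cong (dG G v *_) (sym (τ-det G y)) ⟩
      dG G v * + τ (asMG G) ∎) ⟩
  dG G v * + τ (asMG G) + sum (λ z → ind (adj G v z) * H z) ∎
  where
  open ≡-Reasoning
  L = weightedLaplacian G (dG G)
  K = adjM L (allBut y)
  D = det L (allBut y)
  H : Fin _ → ℤ
  H z = pathSum G z y
  v∈ : allBut y ∋ v
  v∈ = trans (∖-other (tabulate full) v≢y) (Vecₚ.lookup∘tabulate full v)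
  lem : ∀ a b → a ≡ a - b + b
  lem = solve-∀
  lem₂ : ∀ d w a h → d * (w * h) - a * h ≡ (d * w - a) * h
  lem₂ = solve-∀
  lem₃ : ∀ d D w → d * D * w ≡ d * (w * D)
  lem₃ = solve-∀

deg-pos : (G : Graph n) {u v : Fin n} → adj G u v ≡ true → 0 ℕ.< deg G u
deg-pos G {u} {v} e = subst (0 ℕ.<_)
  (sym (trans (countB-size (adj G u)) (∣∖∣ (tabulate (adj G u)) v (trans (Vecₚ.lookup∘tabulate (adj G u) v) e)))) (ℕ.s≤s ℕ.z≤n)

connected-deg-pos : (G : Graph n) → Connected G → {u v : Fin n} → u ≢ v → 0 ℕ.< deg G u
connected-deg-pos G con {u} {v} u≢v with con u v
... | here = contradiction refl u≢v
... | step e _ = deg-pos G e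

-- Any nonnegative integral solution of the first-step equations scaled by N yields the hitting time
-- H x / N. Degrees are positive away from y only: in the graph with one vertex, y has degree 0 and
-- `recip` takes its default value 0.
module FirstStep (G : Graph n) (x y : Fin n) (deg>0 : ∀ {u} → u ≢ y → 0 ℕ.< deg G u)
  (N : ℕ) (N>0 : 0 ℕ.< N) (H : Fin n → ℤ) (H-target : H y ≡ + 0) (H-nonneg : ∀ v → + 0 ℤ.≤ H v)
  (H-step : ∀ {v} → v ≢ y → dG G v * H v ≡ dG G v * + N + sum (λ z → ind (adj G v z) * H z)) where

  private
    h : Fin n → ℚ
    h v = toℚ (H v)

    T : ℚ
    T = ofℕ N

    r : Fin n → ℚ
    r u = recip (deg G u)

    flow : Fin n → ℤ
    flow u = sum (λ v → ind (adj G u v) * H v)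

    -- A common upper bound for the values of H: they are nonnegative, so each is at most their sum.
    K : ℤ
    K = sum H

    -- Built from the unnormalised H, so that one step costs N times the tail probability; the
    -- division by N happens once, in the limit.
    potential : ℕ → ℚ
    potential t = ∑ℚ.sum (λ v → q G x y t v ℚ.* h v)

    h-target : h y ≡ 0ℚ
    h-target = cong toℚ H-target

    h-step : ∀ {u} → u ≢ y → h u ≡ T ℚ.+ r u ℚ.* toℚ (flow u)
    h-step {u} u≢y = begin
      h u ≡⟨ sym (ℚₚ.*-identityˡ (h u)) ⟩
      1ℚ ℚ.* h u ≡⟨ cong (ℚ._* h u) (sym inv) ⟩
      r u ℚ.* d ℚ.* h u ≡⟨ ℚₚ.*-assoc (r u) d (h u) ⟩
      r u ℚ.* (d ℚ.* h u) ≡⟨ cong (r u ℚ.*_) (trans (sym (toℚ-* (dG G u) (H u))) (trans (cong toℚ (H-step u≢y))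
          (trans (toℚ-+ (dG G u * + N) (flow u)) (cong (ℚ._+ toℚ (flow u)) (toℚ-* (dG G u) (+ N)))))) ⟩
      r u ℚ.* (d ℚ.* T ℚ.+ toℚ (flow u)) ≡⟨ ℚₚ.*-distribˡ-+ (r u) (d ℚ.* T) (toℚ (flow u)) ⟩
      r u ℚ.* (d ℚ.* T) ℚ.+ r u ℚ.* toℚ (flow u)
        ≡⟨ cong (ℚ._+ r u ℚ.* toℚ (flow u)) (trans (sym (ℚₚ.*-assoc (r u) d T)) (trans (cong (ℚ._* T) inv) (ℚₚ.*-identityˡ T))) ⟩
      T ℚ.+ r u ℚ.* toℚ (flow u) ∎
      where
      open ≡-Reasoning
      d = ofℕ (deg G u)
      inv : r u ℚ.* d ≡ 1ℚ
      inv = recip-inverse (deg>0 u≢y)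

    q-target : ∀ t → q G x y t y ≡ 0ℚ
    q-target zero with toSum (x ≟ y)
    ... | inj₁ refl rewrite ==-refl x = refl
    ... | inj₂ x≢y rewrite ==-≢ (x≢y ∘ sym) = refl
    q-target (suc t) rewrite ==-refl y = refl

    incoming : ℕ → Fin n → Fin n → ℚ
    incoming t v u = if adj G u v then q G x y t u ℚ.* r u else 0ℚ

    q-step : ∀ t {v} → v ≢ y → q G x y (suc t) v ≡ ∑ℚ.sum (incoming t v)
    q-step t {v} v≢y rewrite ==-≢ v≢y = sumℚ-allFin (incoming t v)

    q-nonneg : ∀ t v → 0ℚ ℚ.≤ q G x y t v
    q-nonneg zero v with (v == x) ∧ not (x == y)
    ... | true = ℚₚ.nonNegative⁻¹ 1ℚ
    ... | false = ℚₚ.≤-refl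
    q-nonneg (suc t) v with toSum (v ≟ y)
    ... | inj₁ refl = ℚₚ.≤-reflexive (sym (q-target (suc t)))
    ... | inj₂ v≢y = subst (0ℚ ℚ.≤_) (sym (q-step t v≢y)) (sumℚ-nonneg one)
      where
      one : ∀ u → 0ℚ ℚ.≤ incoming t v u
      one u with adj G u v
      ... | true = *-nonneg (q-nonneg t u) (recip-nonneg (deg G u))
      ... | false = ℚₚ.≤-refl

    -- At v = y the walk is killed: `q` discards the mass that arrives there, while the right side
    -- still counts it. The two agree because it is counted with weight H y = 0.
    push : ∀ t v → q G x y (suc t) v ℚ.* h v ≡ ∑ℚ.sum (λ u → q G x y t u ℚ.* r u ℚ.* toℚ (ind (adj G u v) * H v))
    push t v with toSum (v ≟ y)
    ... | inj₁ refl = trans (trans (cong (q G x y (suc t) v ℚ.*_) h-target) (ℚₚ.*-zeroʳ (q G x y (suc t) v)))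
      (sym (sumℚ-zero λ u → trans (cong (λ z → q G x y t u ℚ.* r u ℚ.* toℚ (ind (adj G u v) * z)) H-target)
        (trans (cong (λ z → q G x y t u ℚ.* r u ℚ.* toℚ z) (ℤₚ.*-zeroʳ (ind (adj G u v)))) (ℚₚ.*-zeroʳ (q G x y t u ℚ.* r u)))))
    ... | inj₂ v≢y = trans (cong (ℚ._* h v) (q-step t v≢y)) (trans (∑ℚ.*-distribʳ-sum (h v) (incoming t v)) (∑ℚ.sum-cong-≗ one))
      where
      one : ∀ u → incoming t v u ℚ.* h v ≡ q G x y t u ℚ.* r u ℚ.* toℚ (ind (adj G u v) * H v)
      one u with adj G u v
      ... | true = cong (λ z → q G x y t u ℚ.* r u ℚ.* toℚ z) (sym (ℤₚ.*-identityˡ (H v)))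
      ... | false = trans (ℚₚ.*-zeroˡ (h v)) (sym (ℚₚ.*-zeroʳ (q G x y t u ℚ.* r u)))

    potential-next : ∀ t → potential (suc t) ≡ ∑ℚ.sum (λ u → q G x y t u ℚ.* r u ℚ.* toℚ (flow u))
    potential-next t = begin
      potential (suc t) ≡⟨ ∑ℚ.sum-cong-≗ (push t) ⟩
      ∑ℚ.sum (λ v → ∑ℚ.sum (λ u → q G x y t u ℚ.* r u ℚ.* toℚ (ind (adj G u v) * H v)))
        ≡⟨ ∑ℚ.∑-comm (λ v u → q G x y t u ℚ.* r u ℚ.* toℚ (ind (adj G u v) * H v)) ⟩
      ∑ℚ.sum (λ u → ∑ℚ.sum (λ v → q G x y t u ℚ.* r u ℚ.* toℚ (ind (adj G u v) * H v)))
        ≡⟨ ∑ℚ.sum-cong-≗ (λ u → trans (sym (∑ℚ.*-distribˡ-sum (q G x y t u ℚ.* r u) (λ v → toℚ (ind (adj G u v) * H v))))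
             (cong (q G x y t u ℚ.* r u ℚ.*_) (sym (toℚ-sum (λ v → ind (adj G u v) * H v))))) ⟩
      ∑ℚ.sum (λ u → q G x y t u ℚ.* r u ℚ.* toℚ (flow u)) ∎
      where open ≡-Reasoning

    tail-sum : ∀ t → tailProb G x y t ≡ ∑ℚ.sum (q G x y t)
    tail-sum t = sumℚ-allFin (q G x y t)

    pay : ∀ t → potential t ≡ T ℚ.* tailProb G x y t ℚ.+ potential (suc t)
    pay t = begin
      potential t ≡⟨ ∑ℚ.sum-cong-≗ one ⟩
      ∑ℚ.sum (λ u → T ℚ.* q G x y t u ℚ.+ q G x y t u ℚ.* r u ℚ.* toℚ (flow u))
        ≡⟨ ∑ℚ.∑-distrib-+ (λ u → T ℚ.* q G x y t u) (λ u → q G x y t u ℚ.* r u ℚ.* toℚ (flow u)) ⟩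
      ∑ℚ.sum (λ u → T ℚ.* q G x y t u) ℚ.+ ∑ℚ.sum (λ u → q G x y t u ℚ.* r u ℚ.* toℚ (flow u))
        ≡⟨ cong₂ ℚ._+_ (trans (sym (∑ℚ.*-distribˡ-sum T (q G x y t))) (cong (T ℚ.*_) (sym (tail-sum t)))) (sym (potential-next t)) ⟩
      T ℚ.* tailProb G x y t ℚ.+ potential (suc t) ∎
      where
      open ≡-Reasoning
      open +-*-Solver using (solve; _:+_; _:*_; _:=_)
      one : ∀ u → q G x y t u ℚ.* h u ≡ T ℚ.* q G x y t u ℚ.+ q G x y t u ℚ.* r u ℚ.* toℚ (flow u)
      one u with toSum (u ≟ y)
      ... | inj₂ u≢y = trans (cong (q G x y t u ℚ.*_) (h-step u≢y))
        (solve 4 (λ q T r f → q :* (T :+ r :* f) := T :* q :+ q :* r :* f) refl (q G x y t u) T (r u) (toℚ (flow u)))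
      ... | inj₁ refl rewrite q-target t = trans (ℚₚ.*-zeroˡ (h u)) (sym (trans
        (cong₂ ℚ._+_ (ℚₚ.*-zeroʳ T) (trans (cong (ℚ._* toℚ (flow u)) (ℚₚ.*-zeroˡ (r u))) (ℚₚ.*-zeroˡ (toℚ (flow u))))) (ℚₚ.+-identityʳ 0ℚ)))

    potential-start : potential 0 ≡ h x
    potential-start = trans (sumℚ-single (λ v → q G x y 0 v ℚ.* h v) x off) on
      where
      off : ∀ v → v ≢ x → q G x y 0 v ℚ.* h v ≡ 0ℚ
      off v v≢x rewrite ==-≢ v≢x = ℚₚ.*-zeroˡ (h v)
      on : q G x y 0 x ℚ.* h x ≡ h x
      on with toSum (x ≟ y)
      -- A walk that starts at its target has no initial mass, and H y = 0 agrees with this.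
      ... | inj₁ refl = trans (cong (q G x y 0 x ℚ.*_) h-target) (trans (ℚₚ.*-zeroʳ (q G x y 0 x)) (sym h-target))
      ... | inj₂ x≢y rewrite ==-refl x | ==-≢ x≢y = ℚₚ.*-identityˡ (h x)

    K-nonneg : + 0 ℤ.≤ K
    K-nonneg = sum-nonneg H-nonneg

    dominated : ∀ t → potential t ℚ.≤ toℚ K ℚ.* tailProb G x y t
    dominated t = ℚₚ.≤-trans
      (sumℚ-mono λ v → subst (q G x y t v ℚ.* h v ℚ.≤_) (ℚₚ.*-comm (q G x y t v) (toℚ K))
        (*-monoˡ (q-nonneg t v) (toℚ-mono (term≤sum H-nonneg v))))
      (ℚₚ.≤-reflexive (trans (sym (∑ℚ.*-distribˡ-sum (toℚ K) (q G x y t))) (cong (toℚ K ℚ.*_) (sym (tail-sum t)))))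

    bound : toℚ K ℚ.* potential 0 ≡ ofℕ (ℤ.∣ K * H x ∣)
    bound = trans (cong (toℚ K ℚ.*_) potential-start) (trans (sym (toℚ-* K (H x)))
      (cong toℚ (sym (ℤₚ.0≤i⇒+∣i∣≡i (subst (ℤ._≤ K * H x) (ℤₚ.*-zeroʳ K)
        (ℤₚ.*-monoˡ-≤-nonNeg K {{ℤ.nonNegative K-nonneg}} (H-nonneg x)))))))

  hittingTime-solution : HittingTime≡ G x y (recip N ℚ.* toℚ (H x))
  hittingTime-solution = subst (λ z → HittingTime≡ G x y (recip N ℚ.* z)) potential-start
    (potential-converges (partialH G x y) (tailProb G x y) potential T (recip N) (toℚ K) (ℤ.∣ K * H x ∣)
      refl (λ _ → refl)
      (λ t → subst (0ℚ ℚ.≤_) (sym (tail-sum t)) (sumℚ-nonneg (q-nonneg t)))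
      (λ t → sumℚ-nonneg λ v → *-nonneg (q-nonneg t v) (toℚ-nonneg (H-nonneg v)))
      pay dominated
      (toℚ-mono {+ 1} {+ N} (ℤ.+≤+ N>0)) (recip-nonneg N) (recip-inverse N>0)
      (toℚ-nonneg K-nonneg) (ℚₚ.≤-reflexive bound))

theorem2p7 : ∀ {n : ℕ} (G : Graph n) → Connected G → (x y : Fin n) →
    HittingTime≡ G x y (recip (τ (asMG G)) ℚ.* toℚ (pathSum G x y))
    × (∀ (u : Fin n) (P : List (Fin n)) → P ∈ paths G full x u → ¬ (y ∈ P) →
    R G (dG G) (minusPy P y) ≡ + τ (contractTo G (y ∷ P) y))
theorem2p7 G con x y =
  FirstStep.hittingTime-solution G x y (connected-deg-pos G con) (τ (asMG G)) (τ-pos G con y)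
    (λ v → pathSum G v y) (pathSum-target G y) (λ v → pathSum-nonneg G v y) (pathSum-step G y) ,
  λ u P _ _ → R-contract G P y
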